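{- Let $k$ be an algebraically closed field of characteristic zero, let $m\ge1$, and let $\mathcal P_m$ be the coefficient space of degree-exactly-$m$ polynomials in one variable over $k$. Let $\mathcal E_m\subset\mathcal P_m$ be the locus of source-even polynomials, i.e. polynomials of the form $g(Y)=G((Y-c)^2)$ for some $c\in k$ and some polynomial $G\in k[Z]$. If $m$ is odd, then $\mathcal E_m=\varnothing$. If $m=2r$, then $r\ge1$, and $\mathcal E_m$ is the constructible image of the injective incidence map $$\mathbb A^1_c\times\mathcal P_r\longrightarrow\mathcal P_{2r},\qquad(c,G)\longmapsto G((Y-c)^2).$$ Consequently $\mathcal E_{2r}$ is an irreducible constructible subset whose Zariski closure has dimension $r+2$, and this closure has codimension $(2r+1)-(r+2)=r-1$ in $\mathcal P_{2r}$. In particular, for every $m\ge3$, the source-even locus $\mathcal E_m$ is contained in a proper Zariski-closed subset of $\mathcal P_m$.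
   Context: $\mathcal P_m$ is the open subset of the affine space $\mathbb A^{m+1}_k$ of coefficient vectors $(a_0,\ldots,a_m)$ with $a_m\neq0$. -}

module Defs where

open import Algebra.Bundles using (CommutativeRing)
open import Data.Fin.Base using (Fin; zero; suc; toℕ; fromℕ; inject₁)
open import Data.Fin.Properties using (toℕ-fromℕ)
open import Data.List.Base using (List; []; _∷_; map)
open import Data.Nat.Base as ℕ using (ℕ; zero; suc; z≤n; s≤s)
import Data.Nat.Properties as ℕₚ
open import Data.Product.Base using (Σ; Σ-syntax; ∃; ∃-syntax; _×_; _,_; proj₁; proj₂)
open import Data.Sum.Base using (_⊎_)
open import Data.Vec.Functional using (Vector; toList)
open import Function.Definitions using (Congruent; Injective)
open import Level using (Level; _⊔_) renaming (suc to lsuc)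
open import Relation.Binary.Core using (Rel)
open import Relation.Binary.PropositionalEquality as ≡ using (_≡_)
open import Relation.Nullary.Negation.Core using (¬_)
open import Relation.Unary using (Pred; _∈_; _⊆_; _⊂_; _≐_; _∪_; _∩_; ∁; U; Satisfiable; ⋃)

-- d is the supremum, attained, of { n ∣ P n }.
Greatest : ∀ {p} → (ℕ → Set p) → ℕ → Set p
Greatest P d = P d × (∀ n → P n → n ℕ.≤ d)

module Polynomials {c ℓ : Level} (k : CommutativeRing c ℓ) where

  open CommutativeRing k hiding (zero)
  open import Algebra.Definitions.RawMonoid +-rawMonoid using () renaming (_×_ to _·_)

  IsField : Set (c ⊔ ℓ)
  IsField = ¬ (0# ≈ 1#) × (∀ x → ¬ (x ≈ 0#) → ∃[ y ] x * y ≈ 1#)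

  CharacteristicZero : Set ℓ
  CharacteristicZero = ∀ n → ¬ (suc n · 1# ≈ 0#)

  ----------------------------------------------------------------------
  -- Polynomials in one variable are lists of coefficients, constant term
  -- first, identified when all coefficients agree (so trailing zeros are
  -- immaterial).

  Poly : Set c
  Poly = List Carrier

  coeff : Poly → ℕ → Carrier
  coeff []      _       = 0#
  coeff (a ∷ p) zero    = a
  coeff (a ∷ p) (suc i) = coeff p i

  infix 4 _≈ₚ_
  _≈ₚ_ : Rel Poly ℓ
  p ≈ₚ q = ∀ i → coeff p i ≈ coeff q i

  infixl 6 _+ₚ_
  infixl 7 _*ₚ_
  infixr 7 _•_

  _+ₚ_ : Poly → Poly → Poly
  []      +ₚ q       = q
  (a ∷ p) +ₚ []      = a ∷ p
  (a ∷ p) +ₚ (b ∷ q) = (a + b) ∷ (p +ₚ q)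

  _•_ : Carrier → Poly → Poly
  a • p = map (a *_) p

  _*ₚ_ : Poly → Poly → Poly
  []      *ₚ q = []
  (a ∷ p) *ₚ q = a • q +ₚ (0# ∷ (p *ₚ q))

  compose : Poly → Poly → Poly
  compose []      q = []
  compose (a ∷ p) q = (a ∷ []) +ₚ q *ₚ compose p q

  evalₚ : Poly → Carrier → Carrier
  evalₚ []      x = 0#
  evalₚ (a ∷ p) x = a + x * evalₚ p x

  -- (Y - b)²
  [Y-_]² : Carrier → Poly
  [Y- b ]² = (- b ∷ 1# ∷ []) *ₚ (- b ∷ 1# ∷ [])

  ----------------------------------------------------------------------

  𝒫 : ℕ → Set (c ⊔ ℓ)
  𝒫 m = Σ[ a ∈ Vector Carrier (suc m) ] ¬ (a (fromℕ m) ≈ 0#)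

  infix 4 _≈𝒫_
  _≈𝒫_ : ∀ {m} → Rel (𝒫 m) ℓ
  f ≈𝒫 g = ∀ i → proj₁ f i ≈ proj₁ g i

  toPoly : ∀ {m} → 𝒫 m → Poly
  toPoly g = toList (proj₁ g)

  AlgebraicallyClosed : Set (c ⊔ ℓ)
  AlgebraicallyClosed = ∀ n (f : 𝒫 (suc n)) → ∃[ x ] evalₚ (toPoly f) x ≈ 0#

  -- The source-even polynomials of degree m; G is an arbitrary polynomial.
  ℰ : ∀ m → Pred (𝒫 m) (c ⊔ ℓ)
  ℰ m g = ∃[ b ] Σ[ G ∈ Poly ] toPoly g ≈ₚ compose G [Y- b ]²

  ----------------------------------------------------------------------
  -- The Zariski topology on 𝒫 m, induced from affine (m+1)-space

  -- An element of k[x₀,…,xₙ₋₁], presented by a polynomial expression.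
  data MvPoly (n : ℕ) : Set c where
    con     : Carrier → MvPoly n
    var     : Fin n → MvPoly n
    _⊕_ _⊗_ : MvPoly n → MvPoly n → MvPoly n

  eval : ∀ {n} → MvPoly n → Vector Carrier n → Carrier
  eval (con a) x = a
  eval (var i) x = x i
  eval (p ⊕ q) x = eval p x + eval q x
  eval (p ⊗ q) x = eval p x * eval q x

  -- The zero locus in 𝒫 m of a set of polynomials.
  𝒱 : ∀ {m s} → Pred (MvPoly (suc m)) s → Pred (𝒫 m) (c ⊔ ℓ ⊔ s)
  𝒱 S g = ∀ {f} → f ∈ S → eval f (proj₁ g) ≈ 0#

  -- The polynomials vanishing on X.
  ℐ : ∀ {m a} → Pred (𝒫 m) a → Pred (MvPoly (suc m)) (c ⊔ ℓ ⊔ a)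
  ℐ X f = ∀ {g} → g ∈ X → eval f (proj₁ g) ≈ 0#

  module _ {m : ℕ} where

    IsClosed : ∀ {a} → Pred (𝒫 m) a → Set (lsuc (c ⊔ ℓ) ⊔ a)
    IsClosed X = Σ[ S ∈ Pred (MvPoly (suc m)) (c ⊔ ℓ) ] X ≐ 𝒱 S

    IsOpen : ∀ {a} → Pred (𝒫 m) a → Set (lsuc (c ⊔ ℓ) ⊔ a)
    IsOpen X = IsClosed (∁ X)

    -- A finite union of locally closed sets.
    IsConstructible : ∀ {a} → Pred (𝒫 m) a → Set (lsuc (c ⊔ ℓ) ⊔ a)
    IsConstructible X =
      ∃[ n ] Σ[ O ∈ (Fin n → Pred (𝒫 m) (c ⊔ ℓ)) ] Σ[ Z ∈ (Fin n → Pred (𝒫 m) (c ⊔ ℓ)) ]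
        (∀ i → IsOpen (O i)) × (∀ i → IsClosed (Z i)) × X ≐ ⋃[ i ∶ Fin n ] (O i ∩ Z i)

    -- Nonempty, and not the union of two proper relatively closed subsets.
    IsIrreducible : ∀ {a} → Pred (𝒫 m) a → Set (lsuc (c ⊔ ℓ) ⊔ a)
    IsIrreducible X =
      Satisfiable X ×
      (∀ (A B : Pred (𝒫 m) (c ⊔ ℓ)) → IsClosed A → IsClosed B →
         X ⊆ A ∪ B → (X ⊆ A) ⊎ (X ⊆ B))

    -- The intersection of all hypersurfaces containing X; by the three facts
    -- below it is the smallest closed set containing X.
    closure : ∀ {a} → Pred (𝒫 m) a → Pred (𝒫 m) (c ⊔ ℓ ⊔ a)
    closure X = 𝒱 (ℐ X)

    ⊆-closure : ∀ {a} (X : Pred (𝒫 m) a) → X ⊆ closure X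
    ⊆-closure X g∈X f∈I = f∈I g∈X

    closure-isClosed : (X : Pred (𝒫 m) (c ⊔ ℓ)) → IsClosed (closure X)
    closure-isClosed X = ℐ X , (λ h {f} → h {f}) , (λ h {f} → h {f})

    closure-least : ∀ {a b} (X : Pred (𝒫 m) a) (Z : Pred (𝒫 m) b) →
                    IsClosed Z → X ⊆ Z → closure X ⊆ Z
    closure-least X Z (S , Z⊆ , ⊆Z) X⊆Z g∈cl =
      ⊆Z (λ {f} f∈S → g∈cl {f} (λ h∈X → Z⊆ (X⊆Z h∈X) f∈S))

    -- Chains Z₀ ⊊ Z₁ ⊊ … ⊊ Zₙ of irreducible closed sets contained in X.
    record Chain {a} (X : Pred (𝒫 m) a) (n : ℕ) : Set (lsuc (c ⊔ ℓ) ⊔ a) where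
      field
        Z           : Fin (suc n) → Pred (𝒫 m) (c ⊔ ℓ)
        closed      : ∀ i → IsClosed (Z i)
        irreducible : ∀ i → IsIrreducible (Z i)
        strict      : ∀ (i : Fin n) → Z (inject₁ i) ⊂ Z (suc i)
        inside      : ∀ i → Z i ⊆ X

    -- The Krull dimension of a closed set X.
    HasDimension : ∀ {a} → Pred (𝒫 m) a → ℕ → Set (lsuc (c ⊔ ℓ) ⊔ a)
    HasDimension X = Greatest (Chain X)

    -- The codimension in 𝒫 m of an irreducible closed set Y: the greatest
    -- length of a chain starting at Y.
    HasCodimension : ∀ {a} → Pred (𝒫 m) a → ℕ → Set (lsuc (c ⊔ ℓ) ⊔ a)
    HasCodimension Y = Greatest (λ n → Σ[ C ∈ Chain U n ] Chain.Z C zero ≐ Y)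

  ----------------------------------------------------------------------
  -- The map (b , G) ↦ G((Y - b)²).  Its values are given by the
  -- coefficients in degrees 0,…,2r; the lemmas show that the coefficient in
  -- degree 2r is the leading coefficient of G, and that those in higher
  -- degrees vanish.

  private

    open import Relation.Binary.Reasoning.Setoid setoid

    coeff-+ₚ : ∀ p q i → coeff (p +ₚ q) i ≈ coeff p i + coeff q i
    coeff-+ₚ []      q       i       = sym (+-identityˡ _)
    coeff-+ₚ (a ∷ p) []      i       = sym (+-identityʳ _)
    coeff-+ₚ (a ∷ p) (b ∷ q) zero    = refl
    coeff-+ₚ (a ∷ p) (b ∷ q) (suc i) = coeff-+ₚ p q i

    coeff-• : ∀ a p i → coeff (a • p) i ≈ a * coeff p i
    coeff-• a []      i       = sym (zeroʳ a)
    coeff-• a (b ∷ p) zero    = refl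
    coeff-• a (b ∷ p) (suc i) = coeff-• a p i

    coeff-∷*ₚ : ∀ a p q i → coeff ((a ∷ p) *ₚ q) (suc i) ≈ a * coeff q (suc i) + coeff (p *ₚ q) i
    coeff-∷*ₚ a p q i = trans (coeff-+ₚ (a • q) _ (suc i)) (+-congʳ (coeff-• a q (suc i)))

    -- p has degree at most n, with coefficient a in degree n
    Top : Poly → ℕ → Carrier → Set ℓ
    Top p n a = coeff p n ≈ a × (∀ i → n ℕ.< i → coeff p i ≈ 0#)

    coeff-quad : ∀ x y z p i → coeff ((x ∷ y ∷ z ∷ []) *ₚ p) (2 ℕ.+ i) ≈
                 x * coeff p (2 ℕ.+ i) + (y * coeff p (1 ℕ.+ i) + z * coeff p i)
    coeff-quad x y z p i = trans (coeff-∷*ₚ x (y ∷ z ∷ []) p (suc i)) (+-congˡ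
      (trans (coeff-∷*ₚ y (z ∷ []) p i) (+-congˡ (begin
        coeff (z • p +ₚ (0# ∷ [])) i          ≈⟨ coeff-+ₚ (z • p) _ i ⟩
        coeff (z • p) i + coeff (0# ∷ []) i   ≈⟨ +-cong (coeff-• z p i) (zeros i) ⟩
        z * coeff p i + 0#                    ≈⟨ +-identityʳ _ ⟩
        z * coeff p i                         ∎))))
      where
      zeros : ∀ i → coeff (0# ∷ []) i ≈ 0#
      zeros zero    = refl
      zeros (suc i) = refl

    killˡ : ∀ x {y w} → y ≈ 0# → x * y + w ≈ w
    killˡ x y≈0 = trans (+-congʳ (trans (*-congˡ y≈0) (zeroʳ x))) (+-identityˡ _)

    top-quad : ∀ x y {z} p {n a} → z ≈ 1# → Top p n a → Top ((x ∷ y ∷ z ∷ []) *ₚ p) (2 ℕ.+ n) a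
    top-quad x y {z} p {n} {a} z≈1 (pₙ , p>) = lead , above
      where
      lead : coeff ((x ∷ y ∷ z ∷ []) *ₚ p) (2 ℕ.+ n) ≈ a
      lead = begin
        coeff ((x ∷ y ∷ z ∷ []) *ₚ p) (2 ℕ.+ n)  ≈⟨ coeff-quad x y z p n ⟩
        _                                        ≈⟨ killˡ x (p> (2 ℕ.+ n) (ℕₚ.m<n⇒m<1+n (ℕₚ.n<1+n n))) ⟩
        _                                        ≈⟨ killˡ y (p> (1 ℕ.+ n) (ℕₚ.n<1+n n)) ⟩
        z * coeff p n                            ≈⟨ *-cong z≈1 pₙ ⟩
        1# * a                                   ≈⟨ *-identityˡ a ⟩
        a                                        ∎

      above : ∀ i → 2 ℕ.+ n ℕ.< i → coeff ((x ∷ y ∷ z ∷ []) *ₚ p) i ≈ 0#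
      above (suc (suc i)) (s≤s (s≤s n<i)) = begin
        coeff ((x ∷ y ∷ z ∷ []) *ₚ p) (2 ℕ.+ i)  ≈⟨ coeff-quad x y z p i ⟩
        _                                        ≈⟨ killˡ x (p> (2 ℕ.+ i) (ℕₚ.m<n⇒m<1+n (ℕₚ.m<n⇒m<1+n n<i))) ⟩
        _                                        ≈⟨ killˡ y (p> (1 ℕ.+ i) (ℕₚ.m<n⇒m<1+n n<i)) ⟩
        z * coeff p i                            ≈⟨ *-congˡ (p> i n<i) ⟩
        z * 0#                                   ≈⟨ zeroʳ z ⟩
        0#                                       ∎

    top-+ : ∀ a p {n b} → Top p (suc n) b → Top ((a ∷ []) +ₚ p) (suc n) b
    top-+ a p {n} (pₙ , p>) = trans (tail n) pₙ , λ { (suc i) n<i → trans (tail i) (p> (suc i) n<i) }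
      where
      tail : ∀ i → coeff ((a ∷ []) +ₚ p) (suc i) ≈ coeff p (suc i)
      tail i = trans (coeff-+ₚ (a ∷ []) p (suc i)) (+-identityˡ _)

    top-compose : ∀ b r (a : Vector Carrier (suc r)) →
                  Top (compose (toList a) [Y- b ]²) (2 ℕ.* r) (a (fromℕ r))
    top-compose b zero a = base , λ { (suc i) _ → const i }
      where
      q*0 : ∀ i → coeff ([Y- b ]² *ₚ []) i ≈ 0#
      q*0 zero                      = refl
      q*0 (suc zero)                = refl
      q*0 (suc (suc zero))          = refl
      q*0 (suc (suc (suc i)))       = refl

      base : coeff (compose (toList a) [Y- b ]²) 0 ≈ a zero
      base = trans (coeff-+ₚ (a zero ∷ []) ([Y- b ]² *ₚ []) 0)
                   (trans (+-congˡ (q*0 0)) (+-identityʳ _))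

      const : ∀ i → coeff (compose (toList a) [Y- b ]²) (suc i) ≈ 0#
      const i = trans (coeff-+ₚ (a zero ∷ []) ([Y- b ]² *ₚ []) (suc i))
                      (trans (+-identityˡ _) (q*0 (suc i)))
    top-compose b (suc r) a =
      ≡.subst (λ n → Top (compose (toList a) [Y- b ]²) n (a (fromℕ (suc r))))
              (≡.sym (ℕₚ.*-suc 2 r))
              (top-+ (a zero) ([Y- b ]² *ₚ p)
                (top-quad (- b * - b + 0#) (- b * 1# + (1# * - b + 0#)) p
                  (*-identityˡ 1#) (top-compose b r (λ i → a (suc i)))))
      where
      p : Poly
      p = compose (toList (λ i → a (suc i))) [Y- b ]²

    truncate : ∀ n p → (∀ i → n ℕ.≤ i → coeff p i ≈ 0#) →
               toList {n = n} (λ i → coeff p (toℕ i)) ≈ₚ p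
    truncate zero    p       h i       = sym (h i z≤n)
    truncate (suc n) []      h zero    = refl
    truncate (suc n) []      h (suc i) = truncate n [] (λ _ _ → refl) i
    truncate (suc n) (a ∷ p) h zero    = refl
    truncate (suc n) (a ∷ p) h (suc i) = truncate n p (λ j n≤j → h (suc j) (s≤s n≤j)) i

  incidence : ∀ r → Carrier × 𝒫 r → 𝒫 (2 ℕ.* r)
  incidence r (b , a , aᵣ≉0) =
    (λ i → coeff (compose (toList a) [Y- b ]²) (toℕ i)) ,
    λ lead≈0 → aᵣ≉0 (trans (sym (proj₁ (top-compose b r a)))
      (≡.subst (λ i → coeff (compose (toList a) [Y- b ]²) i ≈ 0#) (toℕ-fromℕ (2 ℕ.* r)) lead≈0))

  incidence-correct : ∀ r b (G : 𝒫 r) → toPoly (incidence r (b , G)) ≈ₚ compose (toPoly G) [Y- b ]²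
  incidence-correct r b G =
    truncate (suc (2 ℕ.* r)) (compose (toPoly G) [Y- b ]²) (proj₂ (top-compose b r (proj₁ G)))

  infix 4 _≈𝔸×𝒫_
  _≈𝔸×𝒫_ : ∀ {r} → Rel (Carrier × 𝒫 r) ℓ
  (b , G) ≈𝔸×𝒫 (b′ , G′) = b ≈ b′ × G ≈𝒫 G′

  -- "A map, and injective", with respect to the equality of the field.
  IsInjectiveMap : ∀ {r m} → (Carrier × 𝒫 r → 𝒫 m) → Set (c ⊔ ℓ)
  IsInjectiveMap φ = Congruent _≈𝔸×𝒫_ _≈𝒫_ φ × Injective _≈𝔸×𝒫_ _≈𝒫_ φ

  Image : ∀ {r m} → (Carrier × 𝒫 r → 𝒫 m) → Pred (𝒫 m) (c ⊔ ℓ)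
  Image φ g = ∃[ x ] φ x ≈𝒫 g

{-# OPTIONS --safe #-}

-- For g of degree m, translating the variable by the center c(g) = - aₘ₋₁ / (m aₘ) kills the coefficient
-- of degree m - 1. The center together with the other coefficients of g(Y + c(g)) is a system of regular
-- coordinates on 𝒫 m with polynomial inverse. If g = G((Y - b)²), then m is even, b = c(g), and the odd
-- coefficients of g(Y + c(g)) vanish; conversely these vanishing conditions make g source-even. So ℰ (2r)
-- is closed, and in the coordinates it is a linear subspace. Linear subspaces are irreducible, since two
-- of their points are joined by a segment, on which a product of nonzero polynomial functions is nonzero.
-- Hence the coordinate flag through ℰ (2r) contains all the chains needed.
--
-- The upper bounds on lengths of chains come from algebraic independence: an equation of Z not vanishing
-- on an irreducible Z′ ⊋ Z can be added to polynomials which are algebraically independent on Z, giving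
-- polynomials algebraically independent on Z′; and more than m + 1 polynomials in m + 1 variables are
-- algebraically dependent, by counting coefficients. Continuing a chain below ℰ (2r) up the flag, or the
-- flag below ℰ (2r) up a chain, bounds the dimension and the codimension of ℰ (2r).

module Submission where

open import Defs
open import Algebra.Bundles using (CommutativeRing)
open import Axiom.ExcludedMiddle using (ExcludedMiddle)
open import Data.Empty using (⊥; ⊥-elim)
open import Data.Fin.Base
  using (Fin; zero; suc; toℕ; fromℕ; fromℕ<; inject₁; punchIn; punchOut; combine; finToFun; funToFin)
open import Data.Fin.Properties
  using (toℕ-fromℕ; toℕ-fromℕ<; toℕ-inject₁; toℕ<n; toℕ≤pred[n]; punchIn-punchOut; combine-surjective; finToFun-funToFin)
  renaming (_≟_ to _≟ᶠ_)
open import Data.List.Base using (List; []; _∷_; length; tabulate)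
open import Data.List.Properties using (length-map)
open import Data.List.Relation.Unary.Any using (Any; here; there)
open import Data.List.Relation.Unary.Any.Properties using (tabulate⁺)
open import Data.Nat.Base as ℕ using (ℕ; zero; suc; z≤n; s≤s)
import Data.Nat.Properties as ℕₚ
open import Data.Product.Base using (Σ; Σ-syntax; _×_; _,_; proj₁; proj₂)
open import Data.Sum.Base using (_⊎_; inj₁; inj₂)
open import Data.Unit.Base using (⊤; tt)
open import Data.Vec.Functional as Vec using (Vector; toList)
open import Level using (Level; _⊔_; Lift; lift; lower; 0ℓ)
open import Relation.Binary.Definitions using (tri<; tri≈; tri>)
open import Relation.Binary.PropositionalEquality as ≡ using (_≡_; _≢_)
open import Relation.Nullary.Decidable using (Dec; yes; no; map′; decidable-stable)
open import Relation.Nullary.Negation.Core using (¬_)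
open import Relation.Unary using (Pred; _∈_; _⊆_; _⊂_; _≐_; _∪_; Empty; Satisfiable; U; ∁)

-- Polynomials over a commutative ring: values, translation, algebras of functions.

module RingPolynomials {c ℓ : Level} (k : CommutativeRing c ℓ) where

  open CommutativeRing k hiding (zero)
  open Polynomials k
  open import Relation.Binary.Reasoning.Setoid setoid
  open import Algebra.Definitions.RawMonoid +-rawMonoid using () renaming (_×_ to _·_)
  open import Algebra.Properties.Monoid.Mult +-monoid using (×-congʳ)
  open import Algebra.Properties.Ring ring using (-1*x≈-x)
  open import Algebra.Solver.Ring.NaturalCoefficients.Default commutativeSemiring
    using (solve; _:+_; _:*_; _:=_; con)

  coeff-+ₚ : ∀ p q i → coeff (p +ₚ q) i ≈ coeff p i + coeff q i
  coeff-+ₚ []      q       i       = sym (+-identityˡ _)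
  coeff-+ₚ (a ∷ p) []      i       = sym (+-identityʳ _)
  coeff-+ₚ (a ∷ p) (b ∷ q) zero    = refl
  coeff-+ₚ (a ∷ p) (b ∷ q) (suc i) = coeff-+ₚ p q i

  coeff-• : ∀ a p i → coeff (a • p) i ≈ a * coeff p i
  coeff-• a []      i       = sym (zeroʳ a)
  coeff-• a (b ∷ p) zero    = refl
  coeff-• a (b ∷ p) (suc i) = coeff-• a p i

  coeff-0∷[] : ∀ i → coeff (0# ∷ []) i ≈ 0#
  coeff-0∷[] zero    = refl
  coeff-0∷[] (suc i) = refl

  coeff-∷-cong : ∀ {a b p q} → a ≈ b → p ≈ₚ q → (a ∷ p) ≈ₚ (b ∷ q)
  coeff-∷-cong a≈b p≈q zero    = a≈b
  coeff-∷-cong a≈b p≈q (suc i) = p≈q i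

  coeff-toList : ∀ {n} (a : Vector Carrier n) i → coeff (toList a) (toℕ i) ≡ a i
  coeff-toList a zero    = ≡.refl
  coeff-toList a (suc i) = coeff-toList (λ j → a (suc j)) i

  coeff-toList-≥ : ∀ {n} (a : Vector Carrier n) i → n ℕ.≤ i → coeff (toList a) i ≡ 0#
  coeff-toList-≥ {zero}  a i       _         = ≡.refl
  coeff-toList-≥ {suc n} a (suc i) (s≤s n≤i) = coeff-toList-≥ (λ j → a (suc j)) i n≤i

  toList-cong : ∀ {n} (a b : Vector Carrier n) → (∀ i → a i ≈ b i) → toList a ≈ₚ toList b
  toList-cong {zero}  a b a≈b i       = refl
  toList-cong {suc n} a b a≈b zero    = a≈b zero
  toList-cong {suc n} a b a≈b (suc i) = toList-cong (λ j → a (suc j)) (λ j → b (suc j)) (λ j → a≈b (suc j)) i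

  coeff-toList-ℕ : ∀ n (f : ℕ → Carrier) → (∀ i → n ℕ.≤ i → f i ≈ 0#) →
                   ∀ i → coeff (toList {n = n} (λ i → f (toℕ i))) i ≈ f i
  coeff-toList-ℕ zero    f f≈0 i       = sym (f≈0 i z≤n)
  coeff-toList-ℕ (suc n) f f≈0 zero    = refl
  coeff-toList-ℕ (suc n) f f≈0 (suc i) = coeff-toList-ℕ n (λ i → f (suc i)) (λ j n≤j → f≈0 (suc j) (s≤s n≤j)) i

  -- Values of polynomials

  evalₚ-zero : ∀ p x → (∀ i → coeff p i ≈ 0#) → evalₚ p x ≈ 0#
  evalₚ-zero []      x p≈0 = refl
  evalₚ-zero (a ∷ p) x p≈0 = begin
    a + x * evalₚ p x ≈⟨ +-cong (p≈0 0) (*-congˡ (evalₚ-zero p x (λ i → p≈0 (suc i)))) ⟩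
    0# + x * 0#       ≈⟨ trans (+-identityˡ _) (zeroʳ x) ⟩
    0#                ∎

  evalₚ-cong : ∀ p q {x y} → p ≈ₚ q → x ≈ y → evalₚ p x ≈ evalₚ q y
  evalₚ-cong []      q       p≈q x≈y = sym (evalₚ-zero q _ (λ i → sym (p≈q i)))
  evalₚ-cong (a ∷ p) []      p≈q x≈y = evalₚ-zero (a ∷ p) _ p≈q
  evalₚ-cong (a ∷ p) (b ∷ q) p≈q x≈y =
    +-cong (p≈q 0) (*-cong x≈y (evalₚ-cong p q (λ i → p≈q (suc i)) x≈y))

  evalₚ-congʳ : ∀ p {x y} → x ≈ y → evalₚ p x ≈ evalₚ p y
  evalₚ-congʳ p = evalₚ-cong p p (λ _ → refl)

  evalₚ-+ : ∀ p q x → evalₚ (p +ₚ q) x ≈ evalₚ p x + evalₚ q x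
  evalₚ-+ []      q       x = sym (+-identityˡ _)
  evalₚ-+ (a ∷ p) []      x = sym (+-identityʳ _)
  evalₚ-+ (a ∷ p) (b ∷ q) x = trans (+-congˡ (*-congˡ (evalₚ-+ p q x)))
    (solve 5 (λ a b x p q → a :+ b :+ x :* (p :+ q) := a :+ x :* p :+ (b :+ x :* q))
       refl a b x (evalₚ p x) (evalₚ q x))

  evalₚ-• : ∀ a p x → evalₚ (a • p) x ≈ a * evalₚ p x
  evalₚ-• a []      x = sym (zeroʳ a)
  evalₚ-• a (b ∷ p) x = trans (+-congˡ (*-congˡ (evalₚ-• a p x)))
    (solve 4 (λ a b x p → a :* b :+ x :* (a :* p) := a :* (b :+ x :* p)) refl a b x (evalₚ p x))

  evalₚ-* : ∀ p q x → evalₚ (p *ₚ q) x ≈ evalₚ p x * evalₚ q x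
  evalₚ-* []      q x = sym (zeroˡ _)
  evalₚ-* (a ∷ p) q x = begin
    evalₚ (a • q +ₚ (0# ∷ p *ₚ q)) x
      ≈⟨ evalₚ-+ (a • q) _ x ⟩
    evalₚ (a • q) x + (0# + x * evalₚ (p *ₚ q) x)
      ≈⟨ +-cong (evalₚ-• a q x) (+-congˡ (*-congˡ (evalₚ-* p q x))) ⟩
    a * evalₚ q x + (0# + x * (evalₚ p x * evalₚ q x))
      ≈⟨ solve 4 (λ a x p q → a :* q :+ (con 0 :+ x :* (p :* q)) := (a :+ x :* p) :* q)
           refl a x (evalₚ p x) (evalₚ q x) ⟩
    (a + x * evalₚ p x) * evalₚ q x ∎

  evalₚ-const : ∀ a x → evalₚ (a ∷ []) x ≈ a
  evalₚ-const a x = trans (+-congˡ (zeroʳ x)) (+-identityʳ a)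

  evalₚ-linear : ∀ a b x → evalₚ (a ∷ b ∷ []) x ≈ a + x * b
  evalₚ-linear a b x = +-congˡ (*-congˡ (evalₚ-const b x))

  evalₚ-compose : ∀ p q x → evalₚ (compose p q) x ≈ evalₚ p (evalₚ q x)
  evalₚ-compose []      q x = refl
  evalₚ-compose (a ∷ p) q x = trans (evalₚ-+ (a ∷ []) (q *ₚ compose p q) x)
    (+-cong (evalₚ-const a x) (trans (evalₚ-* q (compose p q) x) (*-congˡ (evalₚ-compose p q x))))

  evalₚ-[Y-]² : ∀ b x → evalₚ [Y- b ]² x ≈ (x + - b) * (x + - b)
  evalₚ-[Y-]² b x = trans (evalₚ-* (- b ∷ 1# ∷ []) (- b ∷ 1# ∷ []) x) (*-cong lin lin)
    where
    lin : evalₚ (- b ∷ 1# ∷ []) x ≈ x + - b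
    lin = trans (evalₚ-linear (- b) 1# x) (trans (+-comm _ _) (+-congʳ (*-identityʳ x)))

  length-+ₚ : ∀ p q {n} → length p ℕ.≤ n → length q ℕ.≤ n → length (p +ₚ q) ℕ.≤ n
  length-+ₚ []      q       p≤ q≤ = q≤
  length-+ₚ (a ∷ p) []      p≤ q≤ = p≤
  length-+ₚ (a ∷ p) (b ∷ q) (s≤s p≤) (s≤s q≤) = s≤s (length-+ₚ p q p≤ q≤)

  length-• : ∀ a p {n} → length p ℕ.≤ n → length (a • p) ℕ.≤ n
  length-• a p p≤ = ≡.subst (ℕ._≤ _) (≡.sym (length-map (a *_) p)) p≤

  -- Length at most `suc d` stands for degree at most `d`; in this form degrees add.
  length-*ₚ : ∀ p q {d e} → length p ℕ.≤ suc d → length q ℕ.≤ suc e →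
              length (p *ₚ q) ℕ.≤ suc (d ℕ.+ e)
  length-*ₚ []          q p≤ q≤ = z≤n
  length-*ₚ (a ∷ [])    q {d} p≤ q≤ =
    length-+ₚ (a • q) _ (length-• a q (ℕₚ.≤-trans q≤ (s≤s (ℕₚ.m≤n+m _ d)))) (s≤s z≤n)
  length-*ₚ (a ∷ b ∷ p) q {suc d} (s≤s p≤) q≤ =
    length-+ₚ (a • q) _ (length-• a q (ℕₚ.≤-trans q≤ (s≤s (ℕₚ.m≤n+m _ (suc d)))))
      (s≤s (length-*ₚ (b ∷ p) q p≤ q≤))

  -- Synthetic division: if `q` is the quotient of `p` by Y - a, then p + a q is the quotient of b +
  -- Y p. Writing `y + a ≈ x` instead of y = x - a leaves only semiring identities to solve.
  factor : ∀ a p → Σ[ q ∈ Poly ] length q ℕ.≤ ℕ.pred (length p) ×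
           (∀ {x y} → y + a ≈ x → evalₚ p x ≈ evalₚ p a + y * evalₚ q x)
  factor a []      = [] , z≤n , λ {x} {y} _ → sym (trans (+-identityˡ _) (zeroʳ y))
  factor a (b ∷ p) with factor a p
  ... | q , q≤ , pq = p +ₚ a • q
      , length-+ₚ p (a • q) ℕₚ.≤-refl (length-• a q (ℕₚ.≤-trans q≤ (ℕₚ.pred[n]≤n)))
      , λ {x} {y} y+a≈x → begin
        b + x * evalₚ p x
          ≈⟨ +-congˡ (*-congʳ (sym y+a≈x)) ⟩
        b + (y + a) * evalₚ p x
          ≈⟨ solve 4 (λ b y a p → b :+ (y :+ a) :* p := b :+ y :* p :+ a :* p)
               refl b y a (evalₚ p x) ⟩
        b + y * evalₚ p x + a * evalₚ p x
          ≈⟨ +-congˡ (*-congˡ (pq y+a≈x)) ⟩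
        b + y * evalₚ p x + a * (evalₚ p a + y * evalₚ q x)
          ≈⟨ solve 6 (λ b y a p pa q → b :+ y :* p :+ a :* (pa :+ y :* q) :=
                        b :+ a :* pa :+ y :* (p :+ a :* q))
               refl b y a (evalₚ p x) (evalₚ p a) (evalₚ q x) ⟩
        b + a * evalₚ p a + y * (evalₚ p x + a * evalₚ q x)
          ≈⟨ +-congˡ (*-congˡ (trans (+-congˡ (sym (evalₚ-• a q x))) (sym (evalₚ-+ p (a • q) x)))) ⟩
        b + a * evalₚ p a + y * evalₚ (p +ₚ a • q) x ∎

  -- Translation p(Y) ↦ p(Y + s)

  τ : Carrier → Poly → Poly
  τ s p = compose p (s ∷ 1# ∷ [])

  evalₚ-τ : ∀ s p x → evalₚ (τ s p) x ≈ evalₚ p (x + s)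
  evalₚ-τ s p x = trans (evalₚ-compose p _ x) (evalₚ-congʳ p
    (trans (evalₚ-linear s 1# x) (trans (+-comm _ _) (+-congʳ (*-identityʳ x)))))

  -- Translation turns a + Y p into a + (Y + s) times the translate of `p`; the list `a ∷ τ s p`
  -- holds the part free of s.
  coeff-τ : ∀ s a p i → coeff (τ s (a ∷ p)) i ≈ s * coeff (τ s p) i + coeff (a ∷ τ s p) i
  coeff-τ s a p i = begin
    coeff ((a ∷ []) +ₚ (s • t +ₚ (0# ∷ (1# • t +ₚ (0# ∷ []))))) i
      ≈⟨ coeff-+ₚ (a ∷ []) ((s ∷ 1# ∷ []) *ₚ t) i ⟩
    coeff (a ∷ []) i + coeff (s • t +ₚ (0# ∷ (1# • t +ₚ (0# ∷ [])))) i
      ≈⟨ +-congˡ (coeff-+ₚ (s • t) _ i) ⟩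
    coeff (a ∷ []) i + (coeff (s • t) i + coeff (0# ∷ (1# • t +ₚ (0# ∷ []))) i)
      ≈⟨ +-congˡ (+-cong (coeff-• s t i) (coeff-∷-cong refl 1•t i)) ⟩
    coeff (a ∷ []) i + (s * coeff t i + coeff (0# ∷ t) i)
      ≈⟨ solve 3 (λ x y z → x :+ (y :+ z) := y :+ (x :+ z)) refl _ _ _ ⟩
    s * coeff t i + (coeff (a ∷ []) i + coeff (0# ∷ t) i)
      ≈⟨ +-congˡ (head i) ⟩
    s * coeff t i + coeff (a ∷ t) i ∎
    where
    t : Poly
    t = τ s p

    1•t : (1# • t +ₚ (0# ∷ [])) ≈ₚ t
    1•t i = trans (coeff-+ₚ (1# • t) _ i)
      (trans (+-cong (trans (coeff-• 1# t i) (*-identityˡ _)) (coeff-0∷[] i)) (+-identityʳ _))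

    head : ∀ i → coeff (a ∷ []) i + coeff (0# ∷ t) i ≈ coeff (a ∷ t) i
    head zero    = +-identityʳ a
    head (suc i) = +-identityˡ _

  coeff-τ-> : ∀ s p n → (∀ i → n ℕ.≤ i → coeff p i ≈ 0#) → ∀ i → n ℕ.≤ i → coeff (τ s p) i ≈ 0#
  coeff-τ-> s []      n       p> i       n≤i = refl
  coeff-τ-> s (a ∷ p) n p> i n≤i = trans (coeff-τ s a p i) (trans (+-cong
      (trans (*-congˡ (coeff-τ-> s p n (λ j n≤j → p> (suc j) (ℕₚ.m≤n⇒m≤1+n n≤j)) i n≤i)) (zeroʳ s))
      (tail n i p> n≤i)) (+-identityˡ _))
    where
    tail : ∀ n i → (∀ i → n ℕ.≤ i → coeff (a ∷ p) i ≈ 0#) → n ℕ.≤ i → coeff (a ∷ τ s p) i ≈ 0#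
    tail n       zero    p> n≤i       = p> zero n≤i
    tail zero    (suc i) p> n≤i       = coeff-τ-> s p 0 (λ j _ → p> (suc j) z≤n) i z≤n
    tail (suc n) (suc i) p> (s≤s n≤i) = coeff-τ-> s p n (λ j n≤j → p> (suc j) (s≤s n≤j)) i n≤i

  coeff-τ-top : ∀ s p n → (∀ i → n ℕ.< i → coeff p i ≈ 0#) → coeff (τ s p) n ≈ coeff p n
  coeff-τ-top s []      n p> = refl
  coeff-τ-top s (a ∷ p) n p> = trans (coeff-τ s a p n) (trans (+-cong
      (trans (*-congˡ (coeff-τ-> s p n (λ j n≤j → p> (suc j) (s≤s n≤j)) n ℕₚ.≤-refl)) (zeroʳ s))
      (tail n p>)) (+-identityˡ _))
    where
    tail : ∀ n → (∀ i → n ℕ.< i → coeff (a ∷ p) i ≈ 0#) → coeff (a ∷ τ s p) n ≈ coeff (a ∷ p) n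
    tail zero    p> = refl
    tail (suc n) p> = coeff-τ-top s p n (λ i n<i → p> (suc i) (s≤s n<i))

  -- The first two terms of the binomial expansion: below the leading term the coefficient changes
  -- by n s times the leading one. Consing `a` shifts indices, so that degree n - 1 of `p` stands at
  -- index `n` without subtraction.
  coeff-τ-next : ∀ s a p n → (∀ i → n ℕ.< i → coeff p i ≈ 0#) →
                 coeff (a ∷ τ s p) n ≈ coeff (a ∷ p) n + n · (s * coeff p n)
  coeff-τ-next s a p       zero    p> = sym (+-identityʳ a)
  coeff-τ-next s a []      (suc n) p> = sym (trans (+-identityˡ _)
    (trans (×-congʳ (suc n) (zeroʳ s)) (×-zero (suc n))))
    where
    ×-zero : ∀ n → n · 0# ≈ 0#
    ×-zero zero    = refl
    ×-zero (suc n) = trans (+-identityˡ _) (×-zero n)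
  coeff-τ-next s a (b ∷ p) (suc n) p> = begin
    coeff (τ s (b ∷ p)) n
      ≈⟨ coeff-τ s b p n ⟩
    s * coeff (τ s p) n + coeff (b ∷ τ s p) n
      ≈⟨ +-cong (*-congˡ (coeff-τ-top s p n p>′)) (coeff-τ-next s b p n p>′) ⟩
    s * coeff p n + (coeff (b ∷ p) n + n · (s * coeff p n))
      ≈⟨ solve 3 (λ x y z → x :+ (y :+ z) := y :+ (x :+ z)) refl _ _ _ ⟩
    coeff (b ∷ p) n + suc n · (s * coeff p n) ∎
    where
    p>′ : ∀ i → n ℕ.< i → coeff p i ≈ 0#
    p>′ i n<i = p> (suc i) (s≤s n<i)

  -- Algebras of functions

  -- Instantiated twice, by polynomial functions of one parameter and by regular functions on `𝒫 m`,
  -- so that closure under coefficients of translates is proved once.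
  record IsSubalgebra {t p} {T : Set t} (P : Pred (T → Carrier) p) : Set (t ⊔ p ⊔ c ⊔ ℓ) where
    field
      resp  : ∀ {F G} → (∀ x → F x ≈ G x) → P F → P G
      const : ∀ a → P (λ _ → a)
      plus  : ∀ {F G} → P F → P G → P (λ x → F x + G x)
      times : ∀ {F G} → P F → P G → P (λ x → F x * G x)

    negate : ∀ {F} → P F → P (λ x → - F x)
    negate PF = resp (λ x → -1*x≈-x _) (times (const (- 1#)) PF)

    coeff-τ-closed : ∀ {s : T → Carrier} {n} {a : T → Vector Carrier n} → P s → (∀ j → P (λ x → a x j)) →
                     ∀ i → P (λ x → coeff (τ (s x) (toList (a x))) i)
    coeff-τ-closed {n = zero}      Ps Pa i = const 0#
    coeff-τ-closed {s} {suc n} {a} Ps Pa i = resp (λ x → sym (coeff-τ (s x) (a x zero) (toList (λ j → a x (suc j))) i))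
      (plus (times Ps (tail i)) (cons i))
      where
      tail : ∀ i → P (λ x → coeff (τ (s x) (toList (λ j → a x (suc j)))) i)
      tail = coeff-τ-closed Ps (λ j → Pa (suc j))

      cons : ∀ i → P (λ x → coeff (a x zero ∷ τ (s x) (toList (λ j → a x (suc j)))) i)
      cons zero    = Pa zero
      cons (suc i) = tail i

    eval-closed : ∀ {n} {a : T → Vector Carrier n} → (∀ j → P (λ x → a x j)) → ∀ f → P (λ x → eval f (a x))
    eval-closed Pa (con b) = const b
    eval-closed Pa (var i) = Pa i
    eval-closed Pa (f ⊕ g) = plus (eval-closed Pa f) (eval-closed Pa g)
    eval-closed Pa (f ⊗ g) = times (eval-closed Pa f) (eval-closed Pa g)

  PolynomialFunction : (Carrier → Carrier) → Set (c ⊔ ℓ)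
  PolynomialFunction F = Σ[ p ∈ Poly ] ∀ t → F t ≈ evalₚ p t

  polynomialFunctions : IsSubalgebra PolynomialFunction
  polynomialFunctions = record
    { resp  = λ F≈G (p , Fp) → p , λ t → trans (sym (F≈G t)) (Fp t)
    ; const = λ a → (a ∷ []) , λ t → sym (evalₚ-const a t)
    ; plus  = λ (p , Fp) (q , Gq) → p +ₚ q , λ t → trans (+-cong (Fp t) (Gq t)) (sym (evalₚ-+ p q t))
    ; times = λ (p , Fp) (q , Gq) → p *ₚ q , λ t → trans (*-cong (Fp t) (Gq t)) (sym (evalₚ-* p q t))
    }

  eval-cong : ∀ {n} (f : MvPoly n) {x y} → (∀ i → x i ≈ y i) → eval f x ≈ eval f y
  eval-cong (con a) x≈y = refl
  eval-cong (var i) x≈y = x≈y i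
  eval-cong (f ⊕ g) x≈y = +-cong (eval-cong f x≈y) (eval-cong g x≈y)
  eval-cong (f ⊗ g) x≈y = *-cong (eval-cong f x≈y) (eval-cong g x≈y)

  -- Degree of the expression: only an upper bound for the degree of the polynomial it denotes,
  -- since cancellation goes unnoticed.
  deg : ∀ {n} → MvPoly n → ℕ
  deg (con a) = 0
  deg (var i) = 1
  deg (f ⊕ g) = deg f ℕ.⊔ deg g
  deg (f ⊗ g) = deg f ℕ.+ deg g

  restrict-to-line : ∀ {n} (f : MvPoly n) (a b : Vector Carrier n) → Σ[ p ∈ Poly ]
                     length p ℕ.≤ suc (deg f) × (∀ t → eval f (λ i → a i + t * b i) ≈ evalₚ p t)
  restrict-to-line (con x) a b = (x ∷ []) , s≤s z≤n , λ t → sym (evalₚ-const x t)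
  restrict-to-line (var i) a b = (a i ∷ b i ∷ []) , s≤s (s≤s z≤n) , λ t → sym (evalₚ-linear (a i) (b i) t)
  restrict-to-line (f ⊕ g) a b with restrict-to-line f a b | restrict-to-line g a b
  ... | p , p≤ , fp | q , q≤ , gq = p +ₚ q
    , length-+ₚ p q (ℕₚ.≤-trans p≤ (s≤s (ℕₚ.m≤m⊔n _ _))) (ℕₚ.≤-trans q≤ (s≤s (ℕₚ.m≤n⊔m (deg f) _)))
    , λ t → trans (+-cong (fp t) (gq t)) (sym (evalₚ-+ p q t))
  restrict-to-line (f ⊗ g) a b with restrict-to-line f a b | restrict-to-line g a b
  ... | p , p≤ , fp | q , q≤ , gq = p *ₚ q , length-*ₚ p q p≤ q≤
    , λ t → trans (*-cong (fp t) (gq t)) (sym (evalₚ-* p q t))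

-- Counting unknowns against linear conditions.

^-distribʳ-* : ∀ n x y → (x ℕ.* y) ℕ.^ n ≡ x ℕ.^ n ℕ.* y ℕ.^ n
^-distribʳ-* zero    x y = ≡.refl
^-distribʳ-* (suc n) x y = ≡.trans (≡.cong (x ℕ.* y ℕ.*_) (^-distribʳ-* n x y))
  (ℕₚ.[m*n]*[o*p]≡[m*o]*[n*p] x y (x ℕ.^ n) (y ℕ.^ n))

-- A polynomial in f₁, …, f_d of degree < M in each has M ^ d coefficients and, for fᵢ of degree ≤ e in
-- n variables, total degree ≤ d M e; vanishing on a grid is then (1 + d M e) ^ n linear conditions.
enough-unknowns : ∀ n d e → n ℕ.< d → Σ[ M ∈ ℕ ] suc (d ℕ.* (M ℕ.* e)) ℕ.^ n ℕ.< M ℕ.^ d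
-- With C = 1 + d e one has 1 + d M e ≤ M C. Taking M = C ^ n + 1 gives (M C) ^ n = M ^ n C ^ n < M
-- ^ (n + 1) ≤ M ^ d.
enough-unknowns n d e n<d = suc (C ℕ.^ n) , (begin-strict
    suc (d ℕ.* (suc (C ℕ.^ n) ℕ.* e)) ℕ.^ n   ≤⟨ ℕₚ.^-monoˡ-≤ n (bound (suc (C ℕ.^ n))) ⟩
    (suc (C ℕ.^ n) ℕ.* C) ℕ.^ n               ≡⟨ ^-distribʳ-* n (suc (C ℕ.^ n)) C ⟩
    suc (C ℕ.^ n) ℕ.^ n ℕ.* C ℕ.^ n           <⟨ ℕₚ.*-monoʳ-< (suc (C ℕ.^ n) ℕ.^ n)
                                                   {{ℕₚ.m^n≢0 (suc (C ℕ.^ n)) n}} (ℕₚ.n<1+n (C ℕ.^ n)) ⟩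
    suc (C ℕ.^ n) ℕ.^ n ℕ.* suc (C ℕ.^ n)     ≡⟨ ℕₚ.*-comm (suc (C ℕ.^ n) ℕ.^ n) (suc (C ℕ.^ n)) ⟩
    suc (C ℕ.^ n) ℕ.^ suc n                   ≤⟨ ℕₚ.^-monoʳ-≤ (suc (C ℕ.^ n)) n<d ⟩
    suc (C ℕ.^ n) ℕ.^ d                       ∎)
  where
  open ℕₚ.≤-Reasoning

  C : ℕ
  C = suc (d ℕ.* e)

  bound : ∀ M {{_ : ℕ.NonZero M}} → suc (d ℕ.* (M ℕ.* e)) ℕ.≤ M ℕ.* C
  bound M = begin
    suc (d ℕ.* (M ℕ.* e))   ≡⟨ ≡.cong suc (ℕₚ.*-assoc d M e) ⟨
    suc (d ℕ.* M ℕ.* e)     ≡⟨ ≡.cong (λ x → suc (x ℕ.* e)) (ℕₚ.*-comm d M) ⟩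
    suc (M ℕ.* d ℕ.* e)     ≡⟨ ≡.cong suc (ℕₚ.*-assoc M d e) ⟩
    suc (M ℕ.* (d ℕ.* e))   ≤⟨ ℕₚ.+-monoˡ-≤ (M ℕ.* (d ℕ.* e)) (ℕ.>-nonZero⁻¹ M) ⟩
    M ℕ.+ M ℕ.* (d ℕ.* e)   ≡⟨ ℕₚ.*-suc M (d ℕ.* e) ⟨
    M ℕ.* C                 ∎

-- Roots, elimination and algebraic dependence in characteristic zero.

module FieldPolynomials {c ℓ : Level} (em : ExcludedMiddle (c ⊔ ℓ)) (k : CommutativeRing c ℓ)
  (isField : Polynomials.IsField k) (char0 : Polynomials.CharacteristicZero k) where

  open CommutativeRing k hiding (zero)
  open Polynomials k
  open RingPolynomials k
  open import Relation.Binary.Reasoning.Setoid setoid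
  open import Algebra.Properties.CommutativeSemigroup ℕₚ.+-commutativeSemigroup using (x∙yz≈y∙xz)
  open import Algebra.Definitions.RawMonoid +-rawMonoid using () renaming (_×_ to _·_)
  open import Algebra.Properties.Monoid.Mult +-monoid using (×-homo-+)
  open import Algebra.Properties.Ring ring using (-1*x≈-x; -‿distribʳ-*)
  open import Algebra.Solver.Ring.NaturalCoefficients.Default commutativeSemiring
    using (solve; _:+_; _:*_; _:=_; con)

  decide : (P : Set ℓ) → Dec P
  decide P = map′ lower lift (em {Lift c P})

  stable : {P : Set ℓ} → ¬ ¬ P → P
  stable {P} = decidable-stable (decide P)

  1≉0 : ¬ (1# ≈ 0#)
  1≉0 1≈0 = proj₁ isField (sym 1≈0)

  cancelˡ : ∀ {x y} → ¬ (x ≈ 0#) → x * y ≈ 0# → y ≈ 0#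
  cancelˡ {x} {y} x≉0 xy≈0 with proj₂ isField x x≉0
  ... | z , xz≈1 = begin
    y             ≈⟨ *-identityˡ y ⟨
    1# * y        ≈⟨ *-congʳ xz≈1 ⟨
    x * z * y     ≈⟨ solve 3 (λ x y z → x :* z :* y := z :* (x :* y)) refl x y z ⟩
    z * (x * y)   ≈⟨ *-congˡ xy≈0 ⟩
    z * 0#        ≈⟨ zeroʳ z ⟩
    0#            ∎

  *-≉0 : ∀ {x y} → ¬ (x ≈ 0#) → ¬ (y ≈ 0#) → ¬ (x * y ≈ 0#)
  *-≉0 x≉0 y≉0 xy≈0 = y≉0 (cancelˡ x≉0 xy≈0)

  ι : ℕ → Carrier
  ι n = n · 1#

  ι-+ : ∀ m n → ι m + ι n ≈ ι (m ℕ.+ n)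
  ι-+ m n = sym (×-homo-+ 1# m n)

  -- Polynomials in one variable

  divide-root : ∀ p s → evalₚ p s ≈ 0# → Σ[ q ∈ Poly ] length q ℕ.≤ ℕ.pred (length p) ×
                (∀ {x} y → y + s ≈ x → evalₚ p x ≈ y * evalₚ q x)
  divide-root p s ps≈0 with factor s p
  ... | q , q≤ , pq = q , q≤ , λ y y+s≈x → trans (pq y+s≈x) (trans (+-congʳ ps≈0) (+-identityˡ _))

  x-s+s≈x : ∀ x s → x + - s + s ≈ x
  x-s+s≈x x s = trans (+-assoc x (- s) s) (trans (+-congˡ (-‿inverseˡ s)) (+-identityʳ x))

  -- After division by the root `ι s` the quotient still vanishes at the later points, because their
  -- differences `ι (suc i)` from `ι s` are nonzero in characteristic zero.
  roots⇒zero : ∀ n p s → length p ℕ.≤ n → (∀ i → i ℕ.< n → evalₚ p (ι (i ℕ.+ s)) ≈ 0#) →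
               ∀ x → evalₚ p x ≈ 0#
  roots⇒zero zero    [] s p≤ p≈0 x = refl
  roots⇒zero (suc n) p  s p≤ p≈0 x with divide-root p (ι s) (p≈0 0 (s≤s z≤n))
  ... | q , q≤ , pq = trans (pq (x + - ι s) (x-s+s≈x x (ι s)))
      (trans (*-congˡ (roots⇒zero n q (suc s) (ℕₚ.≤-trans q≤ (ℕₚ.pred-mono-≤ p≤)) q≈0 x)) (zeroʳ _))
    where
    q≈0 : ∀ i → i ℕ.< n → evalₚ q (ι (i ℕ.+ suc s)) ≈ 0#
    q≈0 i i<n = ≡.subst (λ j → evalₚ q (ι j) ≈ 0#) (≡.sym (ℕₚ.+-suc i s))
      (cancelˡ (char0 i) (trans (sym (pq (ι (suc i)) (ι-+ (suc i) s))) (p≈0 (suc i) (s≤s i<n))))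

  -- Natural roots are split off one at a time, each shortening the polynomial; past all of them
  -- every factor is nonzero.
  eventually-nonzero : ∀ n p {t} → length p ℕ.≤ n → ¬ (evalₚ p t ≈ 0#) →
                       Σ[ N ∈ ℕ ] ∀ i → N ℕ.≤ i → ¬ (evalₚ p (ι i) ≈ 0#)
  eventually-nonzero zero    [] p≤ pt≉0 = ⊥-elim (pt≉0 refl)
  eventually-nonzero (suc n) p {t} p≤ pt≉0 with decide (Σ[ s ∈ ℕ ] evalₚ p (ι s) ≈ 0#)
  ... | no  noroot     = 0 , λ i _ pi≈0 → noroot (i , pi≈0)
  ... | yes (s , ps≈0) with divide-root p (ι s) ps≈0
  ...   | q , q≤ , pq with eventually-nonzero n q {t} (ℕₚ.≤-trans q≤ (ℕₚ.pred-mono-≤ p≤))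
                             (λ qt≈0 → pt≉0 (trans (pq (t + - ι s) (x-s+s≈x t (ι s))) (trans (*-congˡ qt≈0) (zeroʳ _))))
  ...     | N , q≉0 = suc (N ℕ.⊔ s) , nonzero
    where
    nonzero : ∀ i → suc (N ℕ.⊔ s) ℕ.≤ i → ¬ (evalₚ p (ι i) ≈ 0#)
    -- Writing i = suc s + o exhibits the split-off factor as `ι (suc o)`, which `char0` keeps away
    -- from zero.
    nonzero i N⊔s<i pi≈0 with ℕₚ.m≤n⇒∃[o]m+o≡n (ℕₚ.≤-trans (s≤s (ℕₚ.m≤n⊔m N s)) N⊔s<i)
    ... | o , ≡.refl = *-≉0 (char0 o) (q≉0 i (ℕₚ.≤-trans (ℕₚ.m≤m⊔n N s) (ℕₚ.<⇒≤ N⊔s<i)))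
      (trans (sym (pq (ι (suc o)) (trans (ι-+ (suc o) s) (reflexive (≡.cong (λ j → ι (suc j)) (ℕₚ.+-comm o s)))))) pi≈0)

  common-nonzero : ∀ {F G} → PolynomialFunction F → PolynomialFunction G → ∀ {s t} →
                   ¬ (F s ≈ 0#) → ¬ (G t ≈ 0#) → Σ[ u ∈ Carrier ] ¬ (F u ≈ 0#) × ¬ (G u ≈ 0#)
  common-nonzero (p , Fp) (q , Gq) Fs≉0 Gt≉0
    with eventually-nonzero _ p ℕₚ.≤-refl (λ ps≈0 → Fs≉0 (trans (Fp _) ps≈0))
       | eventually-nonzero _ q ℕₚ.≤-refl (λ qt≈0 → Gt≉0 (trans (Gq _) qt≈0))
  ... | M , p≉0 | N , q≉0 = ι (M ℕ.⊔ N)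
      , (λ F≈0 → p≉0 _ (ℕₚ.m≤m⊔n M N) (trans (sym (Fp _)) F≈0))
      , (λ G≈0 → q≉0 _ (ℕₚ.m≤n⊔m M N) (trans (sym (Gq _)) G≈0))

  -- The value at 0 gives the constant term. Then x p(x) is zero everywhere, whereas a nonzero value
  -- of `p` would force nonzero values at large natural numbers.
  coeff-zero : ∀ p → (∀ x → evalₚ p x ≈ 0#) → ∀ i → coeff p i ≈ 0#
  coeff-zero []      p≈0 i       = refl
  coeff-zero (a ∷ p) p≈0 zero    = trans (sym (trans (+-congˡ (zeroˡ _)) (+-identityʳ a))) (p≈0 0#)
  coeff-zero (a ∷ p) p≈0 (suc i) = coeff-zero p (λ x → stable λ px≉0 → absurd x px≉0) i
    where
    absurd : ∀ x → ¬ ¬ (evalₚ p x ≈ 0#)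
    absurd x px≉0 with eventually-nonzero _ p ℕₚ.≤-refl px≉0
    ... | N , p≉0 = *-≉0 (char0 N) (p≉0 (suc N) (ℕₚ.n≤1+n N)) (begin
      ι (suc N) * evalₚ p (ι (suc N))        ≈⟨ +-identityˡ _ ⟨
      0# + ι (suc N) * evalₚ p (ι (suc N))   ≈⟨ +-congʳ (coeff-zero (a ∷ p) p≈0 0) ⟨
      a + ι (suc N) * evalₚ p (ι (suc N))    ≈⟨ p≈0 (ι (suc N)) ⟩
      0#                                   ∎)

  -- Lets identities between coefficient lists be checked on values, where translation, composition
  -- and dilation are transparent.
  evalₚ-injective : ∀ p q → (∀ x → evalₚ p x ≈ evalₚ q x) → p ≈ₚ q
  evalₚ-injective p q p≈q i = begin
    coeff p i                                 ≈⟨ +-identityʳ _ ⟨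
    coeff p i + 0#                            ≈⟨ +-congˡ (-‿inverseˡ _) ⟨
    coeff p i + (- coeff q i + coeff q i)     ≈⟨ +-assoc _ _ _ ⟨
    coeff p i + - coeff q i + coeff q i       ≈⟨ +-congʳ (trans
                                                     (+-congˡ (trans (sym (-1*x≈-x _)) (sym (coeff-• (- 1#) q i))))
                                                     (sym (coeff-+ₚ p _ i))) ⟩
    coeff (p +ₚ (- 1#) • q) i + coeff q i     ≈⟨ +-congʳ (coeff-zero (p +ₚ (- 1#) • q) p-q≈0 i) ⟩
    0# + coeff q i                            ≈⟨ +-identityˡ _ ⟩
    coeff q i                                 ∎
    where
    p-q≈0 : ∀ x → evalₚ (p +ₚ (- 1#) • q) x ≈ 0#
    p-q≈0 x = begin
      evalₚ (p +ₚ (- 1#) • q) x         ≈⟨ evalₚ-+ p ((- 1#) • q) x ⟩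
      evalₚ p x + evalₚ ((- 1#) • q) x  ≈⟨ +-cong (p≈q x) (trans (evalₚ-• (- 1#) q x) (-1*x≈-x _)) ⟩
      evalₚ q x + - evalₚ q x           ≈⟨ -‿inverseʳ _ ⟩
      0#                                ∎

  -- Linear algebra

  record IsLinear {n : ℕ} (φ : Vector Carrier n → Carrier) : Set (c ⊔ ℓ) where
    field
      resp  : ∀ {v w} → (∀ i → v i ≈ w i) → φ v ≈ φ w
      plus  : ∀ v w → φ (λ i → v i + w i) ≈ φ v + φ w
      scale : ∀ a v → φ (λ i → a * v i) ≈ a * φ v

  linear-extension : ∀ {n} {φ : Vector Carrier (suc n) → Carrier} {t : Vector Carrier n → Carrier} →
                     IsLinear φ → IsLinear t → IsLinear (λ v → φ (t v Vec.∷ v))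
  linear-extension φ-lin t-lin = record
    { resp  = λ v≈w → φ.resp λ { zero → t.resp v≈w ; (suc i) → v≈w i }
    ; plus  = λ v w → trans (φ.resp λ { zero → t.plus v w ; (suc i) → refl }) (φ.plus _ _)
    ; scale = λ a v → trans (φ.resp λ { zero → t.scale a v ; (suc i) → refl }) (φ.scale a _)
    }
    where
    module φ = IsLinear φ-lin
    module t = IsLinear t-lin

  linear-zero : ∀ {n} → IsLinear {n} (λ _ → 0#)
  linear-zero = record
    { resp = λ _ → refl ; plus = λ _ _ → sym (+-identityˡ 0#) ; scale = λ a _ → sym (zeroʳ a) }

  linear-+* : ∀ {n φ ψ} a → IsLinear {n} φ → IsLinear ψ → IsLinear (λ v → φ v + a * ψ v)
  linear-+* {φ = φ} {ψ} a φ-lin ψ-lin = record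
    { resp  = λ v≈w → +-cong (φ.resp v≈w) (*-congˡ (ψ.resp v≈w))
    ; plus  = λ v w → trans (+-cong (φ.plus v w) (*-congˡ (ψ.plus v w)))
        (solve 5 (λ a x y z w → x :+ y :+ a :* (z :+ w) := x :+ a :* z :+ (y :+ a :* w)) refl
           a (φ v) (φ w) (ψ v) (ψ w))
    ; scale = λ b v → trans (+-cong (φ.scale b v) (*-congˡ (ψ.scale b v)))
        (solve 4 (λ a b x y → b :* x :+ a :* (b :* y) := b :* (x :+ a :* y)) refl a b (φ v) (ψ v))
    }
    where
    module φ = IsLinear φ-lin
    module ψ = IsLinear ψ-lin

  e₀ : ∀ {n} → Vector Carrier (suc n)
  e₀ = 1# Vec.∷ λ _ → 0#

  eliminate : ∀ {n} {φ : Vector Carrier (suc n) → Carrier} → IsLinear φ → ¬ (φ e₀ ≈ 0#) →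
              Σ[ t ∈ (Vector Carrier n → Carrier) ] IsLinear t × (∀ v → φ (t v Vec.∷ v) ≈ 0#)
  eliminate {n} {φ} φ-lin a≉0 with proj₂ isField (φ e₀) a≉0
  ... | b , ab≈1 = t , linear-+* (- b) linear-zero (linear-extension φ-lin linear-zero) , vanish
    where
    open IsLinear φ-lin

    -- The form is solved for its first unknown: -φ(0, v) / φ(e₀). The summand `0#` matches the
    -- shape produced by `linear-+*`.
    t : Vector Carrier n → Carrier
    t v = 0# + - b * φ (0# Vec.∷ v)

    split : ∀ a v → φ (a Vec.∷ v) ≈ a * φ e₀ + φ (0# Vec.∷ v)
    split a v = trans (resp λ { zero    → sym (trans (+-identityʳ _) (*-identityʳ a))
                              ; (suc i) → sym (trans (+-congʳ (zeroʳ a)) (+-identityˡ _)) })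
                      (trans (plus _ _) (+-congʳ (scale a e₀)))

    ab≈-1 : φ e₀ * - b ≈ - 1#
    ab≈-1 = trans (sym (-‿distribʳ-* _ b)) (-‿cong ab≈1)

    vanish : ∀ v → φ (t v Vec.∷ v) ≈ 0#
    vanish v = begin
      φ (t v Vec.∷ v)
        ≈⟨ split (t v) v ⟩
      (0# + - b * φ (0# Vec.∷ v)) * φ e₀ + φ (0# Vec.∷ v)
        ≈⟨ solve 3 (λ b x a → (con 0 :+ b :* x) :* a :+ x := a :* b :* x :+ x)
             refl (- b) (φ (0# Vec.∷ v)) (φ e₀) ⟩
      φ e₀ * - b * φ (0# Vec.∷ v) + φ (0# Vec.∷ v)
        ≈⟨ +-congʳ (trans (*-congʳ ab≈-1) (-1*x≈-x _)) ⟩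
      - φ (0# Vec.∷ v) + φ (0# Vec.∷ v)
        ≈⟨ -‿inverseˡ _ ⟩
      0# ∎

  -- Gaussian elimination. If no form involves the first unknown, `e₀` is a solution; otherwise a
  -- pivot form is solved for it and substituted into the others, leaving one form and one unknown
  -- fewer.
  nontrivial-kernel : ∀ {m n} → m ℕ.< n → (φ : Fin m → Vector Carrier n → Carrier) → (∀ j → IsLinear (φ j)) →
                      Σ[ v ∈ Vector Carrier n ] (Σ[ i ∈ Fin n ] ¬ (v i ≈ 0#)) × (∀ j → φ j v ≈ 0#)
  nontrivial-kernel {m} {suc n} m<n φ φ-lin with decide (Σ[ j ∈ Fin m ] ¬ (φ j e₀ ≈ 0#))
  ... | no  ∄j = e₀ , (zero , 1≉0) , λ j → stable λ φj≉0 → ∄j (j , φj≉0)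
  nontrivial-kernel {suc m} {suc n} (s≤s m<n) φ φ-lin | yes (p , a≉0) with eliminate (φ-lin p) a≉0
  ... | t , t-lin , pivot with nontrivial-kernel m<n (λ j v → φ (punchIn p j) (t v Vec.∷ v))
                                 (λ j → linear-extension (φ-lin (punchIn p j)) t-lin)
  ... | v , (i , vi≉0) , v-zero = (t v Vec.∷ v) , (suc i , vi≉0) , zeros
    where
    zeros : ∀ j → φ j (t v Vec.∷ v) ≈ 0#
    zeros j with p ≟ᶠ j
    ... | yes ≡.refl = pivot v
    ... | no  p≢j    = ≡.subst (λ j → φ j (t v Vec.∷ v) ≈ 0#) (punchIn-punchOut p≢j)
                         (v-zero (punchOut p≢j))

  -- Algebraic dependence

  -- By induction the slices with first coordinate 0, ..., D - 1 vanish, so every line in the first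
  -- direction carries `D` zeros of a polynomial of degree below `D`. A bare function `F` with
  -- polynomial restrictions to lines passes to slices without any substitution in expressions.
  grid-zero : ∀ n D (F : Vector Carrier n → Carrier) → (∀ {x y : Vector Carrier n} → (∀ i → x i ≈ y i) → F x ≈ F y) →
              (∀ (a b : Vector Carrier n) → Σ[ p ∈ Poly ] length p ℕ.≤ D × (∀ t → F (λ i → a i + t * b i) ≈ evalₚ p t)) →
              (∀ (u : Fin n → Fin D) → F (λ i → ι (toℕ (u i))) ≈ 0#) → ∀ x → F x ≈ 0#
  grid-zero zero    D F F-cong F-line F≈0 x = trans (F-cong λ ()) (F≈0 λ ())
  grid-zero (suc n) D F F-cong F-line F≈0 x with F-line (0# Vec.∷ λ i → x (suc i)) (1# Vec.∷ λ _ → 0#)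
  ... | p , p≤ , Fp = trans
      (F-cong λ { zero → sym (trans (+-identityˡ _) (*-identityʳ _))
                ; (suc i) → sym (trans (+-congˡ (zeroʳ _)) (+-identityʳ _)) })
      (trans (Fp (x zero)) (roots⇒zero D p 0 p≤ p≈0 (x zero)))
    where
    slice≈0 : ∀ (j : Fin D) y → F (ι (toℕ j) Vec.∷ y) ≈ 0#
    slice≈0 j = grid-zero n D (λ y → F (ι (toℕ j) Vec.∷ y))
      (λ x≈y → F-cong λ { zero → refl ; (suc i) → x≈y i })
      (λ a b → let q , q≤ , Fq = F-line (ι (toℕ j) Vec.∷ a) (0# Vec.∷ b) in q , q≤ ,
         λ t → trans (F-cong λ { zero → sym (trans (+-congˡ (zeroʳ t)) (+-identityʳ _)) ; (suc i) → refl }) (Fq t))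
      (λ u → trans (F-cong λ { zero → refl ; (suc i) → refl }) (F≈0 (j Vec.∷ u)))

    p≈0 : ∀ i → i ℕ.< D → evalₚ p (ι (i ℕ.+ 0)) ≈ 0#
    p≈0 i i<D = trans (sym (Fp _)) (trans
      (F-cong λ { zero → trans (+-identityˡ _) (trans (*-identityʳ _) (reflexive (≡.cong ι
                    (≡.trans (ℕₚ.+-identityʳ i) (≡.sym (toℕ-fromℕ< i<D))))))
                ; (suc i) → trans (+-congˡ (zeroʳ _)) (+-identityʳ _) })
      (slice≈0 (fromℕ< i<D) (λ i → x (suc i))))

  -- Polynomials in d variables as lists in the first variable, with coefficients in the remaining
  -- ones. `IsNonzero` asks for one nonzero scalar coefficient, and `substitute` is Horner's scheme.
  MPoly : ℕ → Set c
  MPoly zero    = Carrier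
  MPoly (suc d) = List (MPoly d)

  IsNonzero : ∀ d → MPoly d → Set (c ⊔ ℓ)
  IsNonzero zero    a = Lift c (¬ (a ≈ 0#))
  IsNonzero (suc d) P = Any (IsNonzero d) P

  substitute : ∀ {n} d → MPoly d → (Fin d → MvPoly n) → MvPoly n
  substitute zero    a       fs = con a
  substitute (suc d) []      fs = con 0#
  substitute (suc d) (p ∷ P) fs = substitute d p (λ i → fs (suc i)) ⊕ (fs zero ⊗ substitute (suc d) P fs)

  -- The general polynomial of degree below `M` in each variable; `combine` splits an index into the
  -- exponent of the first variable and an index for the rest.
  fromCoefficients : ∀ M d → Vector Carrier (M ℕ.^ d) → MPoly d
  fromCoefficients M zero    v = v zero
  fromCoefficients M (suc d) v = tabulate λ i → fromCoefficients M d (λ j → v (combine {M} i j))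

  fromCoefficients-nonzero : ∀ M d v i → ¬ (v i ≈ 0#) → IsNonzero d (fromCoefficients M d v)
  fromCoefficients-nonzero M zero    v zero vi≉0 = lift vi≉0
  fromCoefficients-nonzero M (suc d) v i    vi≉0 with combine-surjective {M} {M ℕ.^ d} i
  ... | j , l , ≡.refl = tabulate⁺ {f = λ j → fromCoefficients M d (λ l → v (combine {M} j l))} j
      (fromCoefficients-nonzero M d (λ l → v (combine {M} j l)) l vi≉0)

  linear-∘ : ∀ {m n} {φ : Vector Carrier m → Carrier} (σ : Fin m → Fin n) →
             IsLinear φ → IsLinear (λ v → φ (λ i → v (σ i)))
  linear-∘ σ φ-lin = record
    { resp = λ v≈w → resp (λ i → v≈w (σ i)) ; plus = λ v w → plus _ _ ; scale = λ a v → scale a _ }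
    where open IsLinear φ-lin

  fromCoefficients-linear : ∀ {n} M d (fs : Fin d → MvPoly n) x →
                            IsLinear (λ v → eval (substitute d (fromCoefficients M d v) fs) x)
  fromCoefficients-linear M zero    fs x = record
    { resp = λ v≈w → v≈w zero ; plus = λ _ _ → refl ; scale = λ _ _ → refl }
  fromCoefficients-linear M (suc d) fs x = horner M (combine {M})
    where
    -- An arbitrary number `m` of coefficients and an arbitrary index map `σ`, since peeling off the
    -- leading entry of the list changes both.
    horner : ∀ m (σ : Fin m → Fin (M ℕ.^ d) → Fin (M ℕ.^ suc d)) → IsLinear λ v →
             eval (substitute (suc d) (tabulate λ i → fromCoefficients M d (λ j → v (σ i j))) fs) x
    horner zero    σ = linear-zero
    horner (suc m) σ = linear-+* (eval (fs zero) x)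
      (linear-∘ (σ zero) (fromCoefficients-linear M d (λ i → fs (suc i)) x))
      (horner m (λ i → σ (suc i)))

  fromCoefficients-degree : ∀ {n} M d (fs : Fin d → MvPoly n) e → (∀ i → deg (fs i) ℕ.≤ e) → ∀ v →
                            deg (substitute d (fromCoefficients M d v) fs) ℕ.≤ d ℕ.* (M ℕ.* e)
  fromCoefficients-degree M zero    fs e fs≤ v = z≤n
  fromCoefficients-degree M (suc d) fs e fs≤ v = ℕₚ.≤-trans
      (horner M (λ i → fromCoefficients M d (λ j → v (combine {M} i j)))
        (λ i → fromCoefficients-degree M d (λ j → fs (suc j)) e (λ j → fs≤ (suc j)) (λ j → v (combine {M} i j))))
      (ℕₚ.≤-reflexive (ℕₚ.+-comm (d ℕ.* (M ℕ.* e)) (M ℕ.* e)))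
    where
    horner : ∀ {D} m (Q : Fin m → MPoly d) → (∀ i → deg (substitute d (Q i) (λ j → fs (suc j))) ℕ.≤ D) →
             deg (substitute (suc d) (tabulate Q) fs) ℕ.≤ D ℕ.+ m ℕ.* e
    horner zero    Q Q≤ = z≤n
    horner {D} (suc m) Q Q≤ = ℕₚ.⊔-lub
      (ℕₚ.≤-trans (Q≤ zero) (ℕₚ.m≤m+n D _))
      (ℕₚ.≤-trans (ℕₚ.+-mono-≤ (fs≤ zero) (horner m (λ i → Q (suc i)) (λ i → Q≤ (suc i))))
        (ℕₚ.≤-reflexive (x∙yz≈y∙xz e D (m ℕ.* e))))

  degree-bound : ∀ {n d} (fs : Fin d → MvPoly n) → Σ[ e ∈ ℕ ] ∀ i → deg (fs i) ℕ.≤ e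
  degree-bound {d = zero}  fs = 0 , λ ()
  degree-bound {d = suc d} fs with degree-bound (λ i → fs (suc i))
  ... | e , fs≤ = deg (fs zero) ℕ.⊔ e , λ
    { zero    → ℕₚ.m≤m⊔n _ e
    ; (suc i) → ℕₚ.≤-trans (fs≤ i) (ℕₚ.m≤n⊔m (deg (fs zero)) e) }

  -- The unknowns are the M ^ d coefficients of the relation, the conditions its vanishing at the D
  -- ^ n points of a grid. As `D` exceeds the degree of the substituted polynomial, vanishing on the
  -- grid is vanishing everywhere.
  dependent : ∀ {n d} (fs : Fin d → MvPoly n) → n ℕ.< d →
              Σ[ P ∈ MPoly d ] IsNonzero d P × (∀ x → eval (substitute d P fs) x ≈ 0#)
  dependent {n} {d} fs n<d with degree-bound fs
  ... | e , fs≤ with enough-unknowns n d e n<d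
  ... | M , D^n<M^d with nontrivial-kernel D^n<M^d
                           (λ j v → eval (substitute d (fromCoefficients M d v) fs) (λ i → ι (toℕ (finToFun j i))))
                           (λ j → fromCoefficients-linear M d fs _)
  ... | v , (i , vi≉0) , v-zero = P , fromCoefficients-nonzero M d v i vi≉0 ,
      grid-zero n D (eval f) (eval-cong f)
        (λ a b → let p , p≤ , fp = restrict-to-line f a b in
           p , ℕₚ.≤-trans p≤ (s≤s (fromCoefficients-degree M d fs e fs≤ v)) , fp)
        (λ u → trans
          (eval-cong f λ i → reflexive (≡.cong (λ j → ι (toℕ j)) (≡.sym (finToFun-funToFin u i))))
          (v-zero (funToFin u)))
    where
    D = suc (d ℕ.* (M ℕ.* e))
    P = fromCoefficients M d v
    f = substitute d P fs

-- Closed sets, independence along chains, and regular functions on `𝒫 m`.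

module ZariskiTopology {c ℓ : Level} (em : ExcludedMiddle (c ⊔ ℓ)) (k : CommutativeRing c ℓ)
  (isField : Polynomials.IsField k) (char0 : Polynomials.CharacteristicZero k) where

  open CommutativeRing k hiding (zero)
  open Polynomials k
  open RingPolynomials k
  open FieldPolynomials em k isField char0
  open import Algebra.Properties.Semiring.Exp semiring using (_^_; ^-homo-*)
  open import Algebra.Solver.Ring.NaturalCoefficients.Default commutativeSemiring
    using (solve; _:+_; _:*_; _:=_)

  substitute-zero : ∀ {n} d P (fs : Fin d → MvPoly n) → ¬ IsNonzero d P →
                    ∀ x → eval (substitute d P fs) x ≈ 0#
  substitute-zero zero    a       fs a≡0 x = stable λ a≉0 → a≡0 (lift a≉0)
  substitute-zero (suc d) []      fs P≡0 x = refl
  substitute-zero (suc d) (p ∷ P) fs P≡0 x = trans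
    (+-cong (substitute-zero d p (λ i → fs (suc i)) (λ p≢0 → P≡0 (here p≢0)) x)
      (trans (*-congˡ (substitute-zero (suc d) P fs (λ P≢0 → P≡0 (there P≢0)) x)) (zeroʳ _)))
    (+-identityˡ 0#)

  module _ {m : ℕ} where

    infix 4 _∈D_
    _∈D_ : 𝒫 m → MvPoly (suc m) → Set ℓ
    g ∈D f = ¬ (eval f (proj₁ g) ≈ 0#)

    outside : {X Y : Pred (𝒫 m) (c ⊔ ℓ)} → ¬ (X ⊆ Y) → Σ[ g ∈ 𝒫 m ] g ∈ X × ¬ (g ∈ Y)
    outside X⊈Y = decidable-stable em λ ∄g → X⊈Y λ {g} g∈X →
      decidable-stable em λ g∉Y → ∄g (g , g∈X , g∉Y)

    separate : {Z : Pred (𝒫 m) (c ⊔ ℓ)} → ((S , _) : IsClosed Z) → ∀ {g} → ¬ (g ∈ Z) →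
               Σ[ f ∈ MvPoly (suc m) ] f ∈ S × g ∈D f
    separate (S , _ , ⊇) {g} g∉Z = decidable-stable em λ ∄f → g∉Z (⊇ λ {f} f∈S →
      stable λ f≉0 → ∄f (f , f∈S , f≉0))

    zeroSet : ∀ {I : Set} → (I → 𝒫 m → Carrier) → Pred (𝒫 m) (c ⊔ ℓ)
    zeroSet F g = Lift c (∀ i → F i g ≈ 0#)

    hypersurface-closed : ∀ {I : Set} (f : I → MvPoly (suc m)) → IsClosed (zeroSet λ i g → eval (f i) (proj₁ g))
    hypersurface-closed f = (λ h → Lift ℓ (Σ[ i ∈ _ ] h ≡ f i))
      , (λ { (lift f≈0) (lift (i , ≡.refl)) → f≈0 i })
      , (λ z → lift λ i → z (lift (i , ≡.refl)))

    IsClosed-resp : {X Y : Pred (𝒫 m) (c ⊔ ℓ)} → X ≐ Y → IsClosed X → IsClosed Y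
    IsClosed-resp (X⊆Y , Y⊆X) (S , X⊆𝒱 , 𝒱⊆X) =
      S , (λ {g} g∈Y {f} → X⊆𝒱 (Y⊆X g∈Y) {f}) , (λ {g} g∈𝒱 → X⊆Y (𝒱⊆X λ {f} → g∈𝒱 {f}))

    IsIrreducible-resp : {X Y : Pred (𝒫 m) (c ⊔ ℓ)} → X ≐ Y → IsIrreducible X → IsIrreducible Y
    IsIrreducible-resp {X} {Y} (X⊆Y , Y⊆X) ((g , g∈X) , irr) = (g , X⊆Y g∈X) , λ A B A-closed B-closed Y⊆A∪B →
      transfer (irr A B A-closed B-closed λ g∈X → Y⊆A∪B (X⊆Y g∈X))
      where
      transfer : ∀ {A B : Pred (𝒫 m) (c ⊔ ℓ)} → (X ⊆ A) ⊎ (X ⊆ B) → (Y ⊆ A) ⊎ (Y ⊆ B)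
      transfer (inj₁ X⊆A) = inj₁ λ g∈Y → X⊆A (Y⊆X g∈Y)
      transfer (inj₂ X⊆B) = inj₂ λ g∈Y → X⊆B (Y⊆X g∈Y)

    -- Nonempty open subsets of an irreducible set meet: otherwise the zero loci of `f` and `h`
    -- would cover `Z`, and one of them would contain it.
    generic-point : {Z : Pred (𝒫 m) (c ⊔ ℓ)} → IsIrreducible Z → ∀ f h →
                    Σ[ g ∈ 𝒫 m ] g ∈ Z × g ∈D f → Σ[ g ∈ 𝒫 m ] g ∈ Z × g ∈D h →
                    Σ[ g ∈ 𝒫 m ] g ∈ Z × g ∈D f × g ∈D h
    generic-point {Z} (_ , irr) f h (x , x∈Z , fx≉0) (y , y∈Z , hy≉0) = decidable-stable em λ ∄g →
      absurd (irr (V f) (V h) (hypersurface-closed (λ _ → f)) (hypersurface-closed (λ _ → h))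
        λ {g} g∈Z → cover g λ fg≉0 → stable λ hg≉0 → ∄g (g , g∈Z , fg≉0 , hg≉0))
      where
      V : MvPoly (suc m) → Pred (𝒫 m) (c ⊔ ℓ)
      V f = zeroSet {I = ⊤} λ _ g → eval f (proj₁ g)

      cover : ∀ g → (g ∈D f → eval h (proj₁ g) ≈ 0#) → g ∈ V f ∪ V h
      cover g hg≈0 with decide (eval f (proj₁ g) ≈ 0#)
      ... | yes fg≈0 = inj₁ (lift λ _ → fg≈0)
      ... | no  fg≉0 = inj₂ (lift λ _ → hg≈0 fg≉0)

      absurd : ¬ ((Z ⊆ V f) ⊎ (Z ⊆ V h))
      absurd (inj₁ Z⊆V) = fx≉0 (lower (Z⊆V x∈Z) tt)
      absurd (inj₂ Z⊆V) = hy≉0 (lower (Z⊆V y∈Z) tt)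

    -- d polynomials which remain algebraically independent as functions on X.
    Independent : Pred (𝒫 m) (c ⊔ ℓ) → ℕ → Set (c ⊔ ℓ)
    Independent X d = Σ[ fs ∈ (Fin d → MvPoly (suc m)) ]
      ∀ P → IsNonzero d P → Σ[ g ∈ 𝒫 m ] g ∈ X × g ∈D substitute d P fs

    independent-zero : ∀ {X} → Satisfiable X → Independent X 0
    independent-zero (g , g∈X) = (λ ()) , λ { a (lift a≉0) → g , g∈X , a≉0 }

    independent-⊆ : ∀ {X Y d} → X ⊆ Y → Independent X d → Independent Y d
    independent-⊆ X⊆Y (fs , ind) = fs , λ P P≢0 →
      let g , g∈X , Pg≉0 = ind P P≢0 in g , X⊆Y g∈X , Pg≉0

    -- An equation f of Z not vanishing on Z′ is the new coordinate: a relation P(f, fs) = 0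
    -- on Z′, divided by a power of f, restricts to the nontrivial relation P(0, fs) = 0 on Z.
    independent-suc : ∀ {Z Z′ d} → IsClosed Z → IsIrreducible Z′ → Z ⊂ Z′ →
                      Independent Z d → Independent Z′ (suc d)
    independent-suc {Z} {Z′} {d} Z-closed@(S , Z⊆𝒱 , _) Z′-irr (Z⊆Z′ , Z′⊈Z) (fs , ind)
      with outside Z′⊈Z
    ... | z , z∈Z′ , z∉Z with separate Z-closed z∉Z
    ... | f , f∈S , fz≉0 = fs′ , ind′
      where
      fs′ : Fin (suc d) → MvPoly (suc m)
      fs′ = f Vec.∷ fs

      ind′ : ∀ P → IsNonzero (suc d) P → Σ[ g ∈ 𝒫 m ] g ∈ Z′ × g ∈D substitute (suc d) P fs′
      constant-term : ∀ p P → IsNonzero d p → Σ[ g ∈ 𝒫 m ] g ∈ Z′ × g ∈D substitute (suc d) (p ∷ P) fs′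

      -- At a point of `Z` the new coordinate `f` is zero, so only the term `p` of the relation
      -- survives there.
      constant-term p P p≢0 with ind p p≢0
      ... | g , g∈Z , pg≉0 = g , Z⊆Z′ g∈Z , λ Pg≈0 → pg≉0
          (trans (sym (trans (+-congˡ (trans (*-congʳ (Z⊆𝒱 g∈Z f∈S)) (zeroˡ _))) (+-identityʳ _))) Pg≈0)

      ind′ (p ∷ P) (here p≢0)  = constant-term p P p≢0
      ind′ (p ∷ P) (there P≢0) with em {IsNonzero d p}
      ... | yes p≢0 = constant-term p P p≢0
      -- The relation is now `f` times the shorter one; irreducibility of `Z′` supplies a point
      -- where both factors are nonzero.
      ... | no  p≡0 with generic-point Z′-irr f (substitute (suc d) P fs′) (z , z∈Z′ , fz≉0) (ind′ P P≢0)
      ...   | g , g∈Z′ , fg≉0 , Pg≉0 = g , g∈Z′ , λ pPg≈0 → *-≉0 fg≉0 Pg≉0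
              (trans (sym (trans (+-congʳ (substitute-zero d p fs p≡0 (proj₁ g))) (+-identityˡ _))) pPg≈0)

    -- Each strict inclusion adds one function, starting from the bottom. The family is not packed
    -- as a `Chain`, so that segments of the flag qualify directly.
    independent-chain : ∀ {d} n (Z : Fin (suc n) → Pred (𝒫 m) (c ⊔ ℓ)) → (∀ i → IsClosed (Z i)) →
                        (∀ i → IsIrreducible (Z i)) → (∀ i → Z (inject₁ i) ⊂ Z (suc i)) →
                        Independent (Z zero) d → Independent (Z (fromℕ n)) (n ℕ.+ d)
    independent-chain     zero    Z Z-closed Z-irr Z-strict ind = ind
    independent-chain {d} (suc n) Z Z-closed Z-irr Z-strict ind =
      ≡.subst (Independent (Z (fromℕ (suc n)))) (ℕₚ.+-suc n d)
        (independent-chain n (λ i → Z (suc i)) (λ i → Z-closed (suc i)) (λ i → Z-irr (suc i)) (λ i → Z-strict (suc i))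
          (independent-suc (Z-closed zero) (Z-irr (suc zero)) (Z-strict zero) ind))

    independent-bound : ∀ {X d} → Independent X d → d ℕ.≤ suc m
    independent-bound {d = d} (fs , ind) = ℕₚ.≮⇒≥ λ m<d →
      let P , P≢0 , P≈0 = dependent fs m<d
          g , _ , Pg≉0  = ind P P≢0
      in Pg≉0 (P≈0 (proj₁ g))

    -- Regular functions

    lead : 𝒫 m → Carrier
    lead g = proj₁ g (fromℕ m)

    leadPower : ℕ → MvPoly (suc m)
    leadPower zero    = con 1#
    leadPower (suc e) = var (fromℕ m) ⊗ leadPower e

    eval-leadPower : ∀ e (g : 𝒫 m) → eval (leadPower e) (proj₁ g) ≈ lead g ^ e
    eval-leadPower zero    g = refl
    eval-leadPower (suc e) g = *-congˡ (eval-leadPower e g)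

    -- The functions f / lead ^ e, that is, the polynomial ring localised at the leading
    -- coefficient, with the denominator cleared.
    Regular : Pred (𝒫 m → Carrier) (c ⊔ ℓ)
    Regular F = Σ[ f ∈ MvPoly (suc m) ] Σ[ e ∈ ℕ ] ∀ g → eval f (proj₁ g) ≈ lead g ^ e * F g

    regular-var : ∀ i → Regular (λ g → proj₁ g i)
    regular-var i = var i , 0 , λ g → sym (*-identityˡ _)

    regular-inverse : ∀ {F} → (∀ g → lead g * F g ≈ 1#) → Regular F
    regular-inverse lF≈1 = con 1# , 1 , λ g → sym (trans (*-congʳ (*-identityʳ _)) (lF≈1 g))

    regularFunctions : IsSubalgebra Regular
    regularFunctions = record
      { resp  = λ F≈G (f , e , fF) → f , e , λ g → trans (fF g) (*-congˡ (F≈G g))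
      ; const = λ a → con a , 0 , λ g → sym (*-identityˡ a)
      ; plus  = λ {F} {G} (f , d , fF) (h , e , hG) → (f ⊗ leadPower e) ⊕ (h ⊗ leadPower d) , d ℕ.+ e , λ g →
          trans (+-cong (*-cong (fF g) (eval-leadPower e g)) (*-cong (hG g) (eval-leadPower d g)))
          (trans (solve 4 (λ x y F G → x :* F :* y :+ y :* G :* x := x :* y :* (F :+ G)) refl
                    (lead g ^ d) (lead g ^ e) (F g) (G g))
                 (*-congʳ (sym (^-homo-* (lead g) d e))))
      ; times = λ {F} {G} (f , d , fF) (h , e , hG) → f ⊗ h , d ℕ.+ e , λ g →
          trans (*-cong (fF g) (hG g))
          (trans (solve 4 (λ x y F G → x :* F :* (y :* G) := x :* y :* (F :* G)) refl
                    (lead g ^ d) (lead g ^ e) (F g) (G g))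
                 (*-congʳ (sym (^-homo-* (lead g) d e))))
      }

    -- The leading coefficient is invertible on `𝒫 m`, so a regular function and its numerator have
    -- the same zeros.
    zeroSet-closed : ∀ {I : Set} {F : I → 𝒫 m → Carrier} → (∀ i → Regular (F i)) → IsClosed (zeroSet F)
    zeroSet-closed {F = F} F-reg = IsClosed-resp
      ( (λ { {g} (lift z) → lift λ i → cancelˡ (power≉0 (proj₁ (proj₂ (F-reg i))) g)
               (trans (sym (proj₂ (proj₂ (F-reg i)) g)) (z i)) })
      , (λ { {g} (lift z) → lift λ i → trans (proj₂ (proj₂ (F-reg i)) g)
               (trans (*-congˡ (z i)) (zeroʳ _)) }))
      (hypersurface-closed (λ i → proj₁ (F-reg i)))
      where
      power≉0 : ∀ e (g : 𝒫 m) → ¬ (lead g ^ e ≈ 0#)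
      power≉0 zero    g = 1≉0
      power≉0 (suc e) g = *-≉0 (proj₂ g) (power≉0 e g)

-- Translates of even polynomials and the coordinates given by centering.

module EvenPolynomials {c ℓ : Level} (em : ExcludedMiddle (c ⊔ ℓ)) (k : CommutativeRing c ℓ)
  (isField : Polynomials.IsField k) (char0 : Polynomials.CharacteristicZero k) where

  open CommutativeRing k hiding (zero)
  open Polynomials k
  open RingPolynomials k
  open FieldPolynomials em k isField char0
  open ZariskiTopology em k isField char0
  open import Relation.Binary.Reasoning.Setoid setoid
  open import Algebra.Solver.Ring.NaturalCoefficients.Default commutativeSemiring
    using (solve; _:*_; _:=_)
  open import Algebra.Definitions.RawMonoid +-rawMonoid using () renaming (_×_ to _·_)
  open import Algebra.Properties.Ring ring using (-‿distribˡ-*; -‿distribʳ-*)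
  open import Algebra.Properties.Group +-group using (inverseʳ-unique)

  τ-cong : ∀ {s t} p q → s ≈ t → p ≈ₚ q → τ s p ≈ₚ τ t q
  τ-cong {s} {t} p q s≈t p≈q = evalₚ-injective (τ s p) (τ t q) λ x →
    trans (evalₚ-τ s p x) (trans (evalₚ-cong p q p≈q (+-congˡ s≈t)) (sym (evalₚ-τ t q x)))

  τ-inverse : ∀ {s t} p → s + t ≈ 0# → τ s (τ t p) ≈ₚ p
  τ-inverse {s} {t} p s+t≈0 = evalₚ-injective (τ s (τ t p)) p λ x → begin
    evalₚ (τ s (τ t p)) x    ≈⟨ evalₚ-τ s (τ t p) x ⟩
    evalₚ (τ t p) (x + s)    ≈⟨ evalₚ-τ t p (x + s) ⟩
    evalₚ p (x + s + t)      ≈⟨ evalₚ-congʳ p (trans (+-assoc x s t) (trans (+-congˡ s+t≈0) (+-identityʳ x))) ⟩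
    evalₚ p x                ∎

  -- G(Y²)
  dilate : Poly → Poly
  dilate []      = []
  dilate (a ∷ p) = a ∷ 0# ∷ dilate p

  evalₚ-dilate : ∀ p x → evalₚ (dilate p) x ≈ evalₚ p (x * x)
  evalₚ-dilate []      x = refl
  evalₚ-dilate (a ∷ p) x = +-congˡ (trans (*-congˡ (trans (+-identityˡ _) (*-congˡ (evalₚ-dilate p x))))
    (sym (*-assoc x x _)))

  coeff-dilate-even : ∀ p t → coeff (dilate p) (2 ℕ.* t) ≡ coeff p t
  coeff-dilate-even []      t       = ≡.refl
  coeff-dilate-even (a ∷ p) zero    = ≡.refl
  coeff-dilate-even (a ∷ p) (suc t) =
    ≡.trans (≡.cong (coeff (dilate (a ∷ p))) (ℕₚ.*-suc 2 t)) (coeff-dilate-even p t)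

  coeff-dilate-odd : ∀ p t → coeff (dilate p) (suc (2 ℕ.* t)) ≡ 0#
  coeff-dilate-odd []      t       = ≡.refl
  coeff-dilate-odd (a ∷ p) zero    = ≡.refl
  coeff-dilate-odd (a ∷ p) (suc t) =
    ≡.trans (≡.cong (λ i → coeff (dilate (a ∷ p)) (suc i)) (ℕₚ.*-suc 2 t)) (coeff-dilate-odd p t)

  parity : ∀ i → (Σ[ t ∈ ℕ ] i ≡ 2 ℕ.* t) ⊎ (Σ[ t ∈ ℕ ] i ≡ suc (2 ℕ.* t))
  parity zero    = inj₁ (0 , ≡.refl)
  parity (suc i) with parity i
  ... | inj₁ (t , i≡2t)   = inj₂ (t , ≡.cong suc i≡2t)
  ... | inj₂ (t , i≡1+2t) = inj₁ (suc t , ≡.trans (≡.cong suc i≡1+2t) (≡.sym (ℕₚ.*-suc 2 t)))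

  dilate-evenPart : ∀ r h → (∀ i → 2 ℕ.* r ℕ.< i → coeff h i ≈ 0#) → (∀ t → coeff h (suc (2 ℕ.* t)) ≈ 0#) →
                    h ≈ₚ dilate (toList {n = suc r} λ i → coeff h (2 ℕ.* toℕ i))
  dilate-evenPart r h h> h-odd i with parity i
  ... | inj₁ (t , ≡.refl) = sym (trans (reflexive (coeff-dilate-even (toList {n = suc r} λ i → coeff h (2 ℕ.* toℕ i)) t))
          (coeff-toList-ℕ (suc r) (λ i → coeff h (2 ℕ.* i)) (λ i r<i → h> (2 ℕ.* i) (ℕₚ.*-monoʳ-< 2 r<i)) t))
  ... | inj₂ (t , ≡.refl) = trans (h-odd t)
          (reflexive (≡.sym (coeff-dilate-odd (toList {n = suc r} λ i → coeff h (2 ℕ.* toℕ i)) t)))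

  -- Translating by `b` moves the axis of symmetry to 0 and turns G((Y - b)²) into G(Y²), whose odd
  -- coefficients are visibly zero.
  even⇒τ : ∀ b p G → p ≈ₚ compose G [Y- b ]² → τ b p ≈ₚ dilate G
  even⇒τ b p G p≈ = evalₚ-injective (τ b p) (dilate G) λ x → begin
    evalₚ (τ b p) x                                ≈⟨ evalₚ-τ b p x ⟩
    evalₚ p (x + b)                                ≈⟨ evalₚ-cong p (compose G [Y- b ]²) p≈ refl ⟩
    evalₚ (compose G [Y- b ]²) (x + b)             ≈⟨ evalₚ-compose G [Y- b ]² (x + b) ⟩
    evalₚ G (evalₚ [Y- b ]² (x + b))               ≈⟨ evalₚ-congʳ G (evalₚ-[Y-]² b (x + b)) ⟩
    evalₚ G ((x + b + - b) * (x + b + - b))        ≈⟨ evalₚ-congʳ G (*-cong (cancel x) (cancel x)) ⟩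
    evalₚ G (x * x)                                ≈⟨ evalₚ-dilate G x ⟨
    evalₚ (dilate G) x                             ∎
    where
    cancel : ∀ x → x + b + - b ≈ x
    cancel x = trans (+-assoc x b (- b)) (trans (+-congˡ (-‿inverseʳ b)) (+-identityʳ x))

  τ⇒even : ∀ b p G → τ b p ≈ₚ dilate G → p ≈ₚ compose G [Y- b ]²
  τ⇒even b p G τp≈ = evalₚ-injective p (compose G [Y- b ]²) λ x → begin
    evalₚ p x                                  ≈⟨ evalₚ-congʳ p (x-s+s≈x x b) ⟨
    evalₚ p (x + - b + b)                      ≈⟨ evalₚ-τ b p (x + - b) ⟨
    evalₚ (τ b p) (x + - b)                    ≈⟨ evalₚ-cong (τ b p) (dilate G) τp≈ refl ⟩
    evalₚ (dilate G) (x + - b)                 ≈⟨ evalₚ-dilate G (x + - b) ⟩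
    evalₚ G ((x + - b) * (x + - b))            ≈⟨ evalₚ-congʳ G (evalₚ-[Y-]² b x) ⟨
    evalₚ G (evalₚ [Y- b ]² x)                 ≈⟨ evalₚ-compose G [Y- b ]² x ⟨
    evalₚ (compose G [Y- b ]²) x               ∎

  module _ {m : ℕ} where

    coeff-toPoly : (g : 𝒫 m) → ∀ i → coeff (toPoly g) (toℕ i) ≡ proj₁ g i
    coeff-toPoly g = coeff-toList (proj₁ g)

    coeff-top : (g : 𝒫 m) → coeff (toPoly g) m ≡ proj₁ g (fromℕ m)
    coeff-top g = ≡.trans (≡.cong (coeff (toPoly g)) (≡.sym (toℕ-fromℕ m))) (coeff-toPoly g (fromℕ m))

    coeff-top≉0 : (g : 𝒫 m) → ¬ (coeff (toPoly g) m ≈ 0#)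
    coeff-top≉0 g top≈0 = proj₂ g (trans (reflexive (≡.sym (coeff-top g))) top≈0)

    coeff-above : (g : 𝒫 m) → ∀ i → m ℕ.< i → coeff (toPoly g) i ≈ 0#
    coeff-above g i m<i = reflexive (coeff-toList-≥ (proj₁ g) i m<i)

    coeffs-injective : (g h : 𝒫 m) → toPoly g ≈ₚ toPoly h → g ≈𝒫 h
    coeffs-injective g h g≈h i = trans (reflexive (≡.sym (coeff-toPoly g i)))
      (trans (g≈h (toℕ i)) (reflexive (coeff-toPoly h i)))

  -- Translation keeps the leading coefficient, which in G(Y²) would sit in odd degree and therefore
  -- vanish.
  odd⇒not-even : ∀ r → Empty (ℰ (suc (2 ℕ.* r)))
  odd⇒not-even r g (b , G , g≈) = coeff-top≉0 g (begin
    coeff (toPoly g) (suc (2 ℕ.* r))          ≈⟨ coeff-τ-top b (toPoly g) (suc (2 ℕ.* r)) (coeff-above g) ⟨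
    coeff (τ b (toPoly g)) (suc (2 ℕ.* r))    ≈⟨ even⇒τ b (toPoly g) G g≈ (suc (2 ℕ.* r)) ⟩
    coeff (dilate G) (suc (2 ℕ.* r))          ≡⟨ coeff-dilate-odd G r ⟩
    0#                                        ∎)

  ·≈ι* : ∀ n x → n · x ≈ ι n * x
  ·≈ι* zero    x = sym (zeroˡ x)
  ·≈ι* (suc n) x = trans (+-cong (sym (*-identityˡ x)) (·≈ι* n x)) (sym (distribʳ x 1# (ι n)))

  -- The degree is m = `suc n`, so that the coefficient to be killed has index `n`.
  module Coordinates (n : ℕ) where

    inv : 𝒫 (suc n) → Carrier
    inv g = proj₁ (proj₂ isField (lead g) (proj₂ g))

    lead*inv≈1 : ∀ g → lead g * inv g ≈ 1#
    lead*inv≈1 g = proj₂ (proj₂ isField (lead g) (proj₂ g))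

    low : 𝒫 (suc n) → Carrier
    low g = proj₁ g (inject₁ (fromℕ n))

    1/m : Carrier
    1/m = proj₁ (proj₂ isField (ι (suc n)) (char0 n))

    m*1/m≈1 : ι (suc n) * 1/m ≈ 1#
    m*1/m≈1 = proj₂ (proj₂ isField (ι (suc n)) (char0 n))

    -- The translation that kills the coefficient of degree m - 1.
    center : 𝒫 (suc n) → Carrier
    center g = - (1/m * (low g * inv g))

    private
      normalize : ∀ g s → 1/m * (ι (suc n) * (s * lead g) * inv g) ≈ s
      normalize g s = begin
        1/m * (ι (suc n) * (s * lead g) * inv g)
          ≈⟨ solve 5 (λ d m s l i → d :* (m :* (s :* l) :* i) := m :* d :* (l :* i) :* s) refl
               1/m (ι (suc n)) s (lead g) (inv g) ⟩
        ι (suc n) * 1/m * (lead g * inv g) * s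
          ≈⟨ *-congʳ (*-cong m*1/m≈1 (lead*inv≈1 g)) ⟩
        1# * 1# * s
          ≈⟨ trans (*-congʳ (*-identityˡ 1#)) (*-identityˡ s) ⟩
        s ∎

    center-root : ∀ g → low g + suc n · (center g * lead g) ≈ 0#
    center-root g = begin
      low g + suc n · (center g * lead g)
        ≈⟨ +-congˡ (·≈ι* (suc n) _) ⟩
      low g + ι (suc n) * (- (1/m * (low g * inv g)) * lead g)
        ≈⟨ +-congˡ (trans (*-congˡ (sym (-‿distribˡ-* _ _))) (sym (-‿distribʳ-* _ _))) ⟩
      low g + - (ι (suc n) * (1/m * (low g * inv g) * lead g))
        ≈⟨ +-congˡ (-‿cong (trans
             (solve 5 (λ d m a l i → m :* (d :* (a :* i) :* l) := m :* d :* (l :* i) :* a) refl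
               1/m (ι (suc n)) (low g) (lead g) (inv g))
             (trans (*-congʳ (trans (*-cong m*1/m≈1 (lead*inv≈1 g)) (*-identityˡ 1#))) (*-identityˡ _)))) ⟩
      low g + - low g
        ≈⟨ -‿inverseʳ _ ⟩
      0# ∎

    center-unique : ∀ g s → low g + suc n · (s * lead g) ≈ 0# → s ≈ center g
    center-unique g s root = begin
      s                                            ≈⟨ normalize g s ⟨
      1/m * (ι (suc n) * (s * lead g) * inv g)     ≈⟨ *-congˡ (*-congʳ (·≈ι* (suc n) (s * lead g))) ⟨
      1/m * (suc n · (s * lead g) * inv g)         ≈⟨ *-congˡ (*-congʳ (inverseʳ-unique (low g) _ root)) ⟩
      1/m * (- low g * inv g)                      ≈⟨ *-congˡ (-‿distribˡ-* (low g) (inv g)) ⟨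
      1/m * - (low g * inv g)                      ≈⟨ -‿distribʳ-* 1/m _ ⟨
      center g                                     ∎

    coeff-low : ∀ g s → coeff (τ s (toPoly g)) n ≈ low g + suc n · (s * lead g)
    coeff-low g s = trans (next (toPoly g) (coeff-above g)) (+-cong
        (reflexive (≡.trans (≡.cong (coeff (toPoly g)) (≡.sym (≡.trans (toℕ-inject₁ (fromℕ n)) (toℕ-fromℕ n))))
          (coeff-toPoly g (inject₁ (fromℕ n)))))
        (×-congʳ (suc n) (*-congˡ (reflexive (coeff-top g)))))
      where
      open import Algebra.Properties.Monoid.Mult +-monoid using (×-congʳ)

      next : ∀ p → (∀ i → suc n ℕ.< i → coeff p i ≈ 0#) →
             coeff (τ s p) n ≈ coeff p n + suc n · (s * coeff p (suc n))
      -- The dummy entry `0#` raises indices by one; at index `suc n` it disappears by computation.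
      next p p> = coeff-τ-next s 0# p (suc n) p>

    centered : 𝒫 (suc n) → Poly
    centered g = τ (center g) (toPoly g)

    centered-low : ∀ g → coeff (centered g) n ≈ 0#
    centered-low g = trans (coeff-low g (center g)) (center-root g)

    centered-unique : ∀ g s → coeff (τ s (toPoly g)) n ≈ 0# → s ≈ center g
    centered-unique g s low≈0 = center-unique g s (trans (sym (coeff-low g s)) low≈0)

    -- Index `n` is a vacant slot, as the centered polynomial has coefficient zero there. The center
    -- is stored in it, and writing `0#` back recovers the polynomial.
    replace : Carrier → (ℕ → Carrier) → ℕ → Carrier
    replace a x i with i ℕₚ.≟ n
    ... | yes _ = a
    ... | no  _ = x i

    replace-≡ : ∀ a x → replace a x n ≡ a
    replace-≡ a x with n ℕₚ.≟ n
    ... | yes _  = ≡.refl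
    ... | no n≢n = ⊥-elim (n≢n ≡.refl)

    replace-≢ : ∀ a x {i} → i ≢ n → replace a x i ≡ x i
    replace-≢ a x {i} i≢n with i ℕₚ.≟ n
    ... | yes i≡n = ⊥-elim (i≢n i≡n)
    ... | no  _   = ≡.refl

    replace-elim : ∀ {a x i y} → (i ≡ n → a ≈ y) → (i ≢ n → x i ≈ y) → replace a x i ≈ y
    replace-elim {i = i} a≈y x≈y with i ℕₚ.≟ n
    ... | yes i≡n = a≈y i≡n
    ... | no  i≢n = x≈y i≢n

    replace-cong : ∀ {a b x y i} → a ≈ b → x i ≈ y i → replace a x i ≈ replace b y i
    replace-cong {i = i} a≈b x≈y with i ℕₚ.≟ n
    ... | yes _ = a≈b
    ... | no  _ = x≈y

    replace-closed : ∀ {t p} {T : Set t} {P : Pred (T → Carrier) p} {a : T → Carrier} {x : T → ℕ → Carrier} i →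
                     P a → P (λ t → x t i) → P (λ t → replace (a t) (x t) i)
    replace-closed i Pa Px with i ℕₚ.≟ n
    ... | yes _ = Pa
    ... | no  _ = Px

    n≢1+n : suc n ≢ n
    n≢1+n = ℕₚ.1+n≢n

    opaque

      -- Coordinates on 𝒫 (suc n): the center and the remaining coefficients of the centered polynomial.
      ξ : 𝒫 (suc n) → ℕ → Carrier
      ξ g = replace (center g) (coeff (centered g))

      normalForm : (ℕ → Carrier) → Vector Carrier (suc (suc n))
      normalForm x i = replace 0# x (toℕ i)

      -- Inverse to `ξ`: restore the centered polynomial and translate it back. No division occurs,
      -- so `φ` is polynomial where `ξ` is only regular.
      φ : (ℕ → Carrier) → Vector Carrier (suc (suc n))
      φ x i = coeff (τ (- x n) (toList (normalForm x))) (toℕ i)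

      ξ-coeff : ∀ g {i} → i ≢ n → ξ g i ≡ coeff (centered g) i
      ξ-coeff g = replace-≢ (center g) (coeff (centered g))

      normalForm-top : ∀ x → coeff (toList (normalForm x)) (suc n) ≡ x (suc n)
      normalForm-top x = ≡.trans (≡.cong (coeff (toList (normalForm x))) (≡.sym (toℕ-fromℕ (suc n))))
        (≡.trans (coeff-toList (normalForm x) (fromℕ (suc n)))
          (≡.trans (≡.cong (replace 0# x) (toℕ-fromℕ (suc n))) (replace-≢ 0# x n≢1+n)))

      normalForm-above : ∀ x i → suc n ℕ.< i → coeff (toList (normalForm x)) i ≈ 0#
      normalForm-above x i n<i = reflexive (coeff-toList-≥ (normalForm x) i n<i)

      φ-top : ∀ x → φ x (fromℕ (suc n)) ≈ x (suc n)
      φ-top x = trans (reflexive (≡.cong (coeff (τ (- x n) (toList (normalForm x)))) (toℕ-fromℕ (suc n))))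
        (trans (coeff-τ-top (- x n) (toList (normalForm x)) (suc n) (normalForm-above x)) (reflexive (normalForm-top x)))

      φ-ξ : ∀ g i → φ (ξ g) i ≈ proj₁ g i
      φ-ξ g i = begin
        coeff (τ (- ξ g n) (toList (normalForm (ξ g)))) (toℕ i)
          ≈⟨ τ-cong (toList (normalForm (ξ g))) (centered g) (-‿cong (reflexive (replace-≡ _ _))) normalForm-ξ (toℕ i) ⟩
        coeff (τ (- center g) (centered g)) (toℕ i)
          ≈⟨ τ-inverse (toPoly g) (-‿inverseˡ (center g)) (toℕ i) ⟩
        coeff (toPoly g) (toℕ i)
          ≡⟨ coeff-toPoly g i ⟩
        proj₁ g i ∎
        where
        replaced : ∀ i → replace 0# (ξ g) i ≈ coeff (centered g) i
        replaced i = replace-elim (λ { ≡.refl → sym (centered-low g) })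
          (λ i≢n → reflexive (replace-≢ (center g) (coeff (centered g)) i≢n))

        normalForm-ξ : toList (normalForm (ξ g)) ≈ₚ centered g
        normalForm-ξ i = trans (toList-cong (normalForm (ξ g)) (λ j → coeff (centered g) (toℕ j)) (λ j → replaced (toℕ j)) i)
          (coeff-toList-ℕ (suc (suc n)) (coeff (centered g))
            (coeff-τ-> (center g) (toPoly g) (suc (suc n)) (coeff-above g)) i)

      φ-cong : ∀ {x y} → (∀ i → x i ≈ y i) → ∀ i → φ x i ≈ φ y i
      φ-cong {x} {y} x≈y i = τ-cong (toList (normalForm x)) (toList (normalForm y)) (-‿cong (x≈y n))
        (toList-cong (normalForm x) (normalForm y) (λ j → replace-cong {x = x} {y} refl (x≈y (toℕ j)))) (toℕ i)

      ξ-top : ∀ g → ξ g (suc n) ≈ lead g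
      ξ-top g = trans (reflexive (replace-≢ _ _ n≢1+n))
        (trans (coeff-τ-top (center g) (toPoly g) (suc n) (coeff-above g)) (reflexive (coeff-top g)))

      φ-polynomial : ∀ {x : Carrier → ℕ → Carrier} → (∀ i → PolynomialFunction (λ t → x t i)) →
                     ∀ i → PolynomialFunction (λ t → φ (x t) i)
      φ-polynomial {x} x-poly i = coeff-τ-closed {a = λ t → normalForm (x t)} (negate (x-poly n))
        (λ j → replace-closed {P = PolynomialFunction} {x = x} (toℕ j) (const 0#) (x-poly (toℕ j))) (toℕ i)
        where open IsSubalgebra polynomialFunctions

      ξ-regular : ∀ i → Regular (λ g → ξ g i)
      ξ-regular i = replace-closed {P = Regular} {center} {λ g → coeff (centered g)} i
          center-regular (coeff-τ-closed {a = proj₁} center-regular regular-var i)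
        where
        open IsSubalgebra regularFunctions
        center-regular : Regular center
        center-regular = negate (times (const 1/m) (times (regular-var _) (regular-inverse lead*inv≈1)))

    point : (x : ℕ → Carrier) → ¬ (x (suc n) ≈ 0#) → 𝒫 (suc n)
    point x top≉0 = φ x , λ top≈0 → top≉0 (trans (sym (φ-top x)) top≈0)

    opaque

      unfolding ξ φ

      toPoly-point : ∀ x top≉0 → toPoly (point x top≉0) ≈ₚ τ (- x n) (toList (normalForm x))
      toPoly-point x top≉0 = coeff-toList-ℕ (suc (suc n)) (coeff (τ (- x n) (toList (normalForm x))))
        (coeff-τ-> (- x n) (toList (normalForm x)) (suc (suc n)) (normalForm-above x))

      coeff-normalForm : ∀ x i → i ℕ.≤ suc n → coeff (toList (normalForm x)) i ≡ replace 0# x i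
      coeff-normalForm x i i≤1+n = ≡.trans (≡.cong (coeff (toList (normalForm x))) (≡.sym (toℕ-fromℕ< (s≤s i≤1+n))))
        (≡.trans (coeff-toList (normalForm x) (fromℕ< (s≤s i≤1+n))) (≡.cong (replace 0# x) (toℕ-fromℕ< (s≤s i≤1+n))))

      τ-point : ∀ x top≉0 → τ (x n) (toPoly (point x top≉0)) ≈ₚ toList (normalForm x)
      τ-point x top≉0 i = trans
        (τ-cong (toPoly (point x top≉0)) (τ (- x n) (toList (normalForm x))) refl (toPoly-point x top≉0) i)
        (τ-inverse {x n} { - x n} (toList (normalForm x)) (-‿inverseʳ (x n)) i)

      -- The translation killing the coefficient of degree `n` is unique, and the normal form has
      -- coefficient zero there.
      center-point : ∀ x top≉0 → x n ≈ center (point x top≉0)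
      center-point x top≉0 = centered-unique (point x top≉0) (x n) (trans (τ-point x top≉0 n)
        (reflexive (≡.trans (coeff-normalForm x n (ℕₚ.n≤1+n n)) (replace-≡ 0# x))))

      -- The bound on `i` is needed because `φ` ignores the entries of `x` beyond index `suc n`.
      ξ-point : ∀ x top≉0 i → i ℕ.≤ suc n → ξ (point x top≉0) i ≈ x i
      ξ-point x top≉0 i i≤1+n = replace-elim (λ { ≡.refl → sym (center-point x top≉0) }) λ i≢n → begin
        coeff (centered (point x top≉0)) i
          ≈⟨ τ-cong (toPoly (point x top≉0)) (toPoly (point x top≉0)) (center-point x top≉0) (λ _ → refl) i ⟨
        coeff (τ (x n) (toPoly (point x top≉0))) i
          ≈⟨ τ-point x top≉0 i ⟩
        coeff (toList (normalForm x)) i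
          ≡⟨ ≡.trans (coeff-normalForm x i i≤1+n) (replace-≢ 0# x i≢n) ⟩
        x i ∎

  -- `G` collects the even coefficients of the translate. Its leading coefficient is that of `g`,
  -- hence nonzero, so its degree is exactly `r`.
  odd-free⇒even : ∀ r (g : 𝒫 (2 ℕ.* r)) s → (∀ t → coeff (τ s (toPoly g)) (suc (2 ℕ.* t)) ≈ 0#) →
                  Σ[ G ∈ 𝒫 r ] toPoly g ≈ₚ compose (toPoly G) [Y- s ]²
  odd-free⇒even r g s odd≈0 = (G , G≉0) , τ⇒even s (toPoly g) (toList G)
      (dilate-evenPart r h (coeff-τ-> s (toPoly g) (suc (2 ℕ.* r)) (coeff-above g)) odd≈0)
    where
    h : Poly
    h = τ s (toPoly g)

    G : Vector Carrier (suc r)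
    G i = coeff h (2 ℕ.* toℕ i)

    G≉0 : ¬ (G (fromℕ r) ≈ 0#)
    G≉0 top≈0 = coeff-top≉0 g (trans (sym (coeff-τ-top s (toPoly g) (2 ℕ.* r) (coeff-above g)))
      (trans (reflexive (≡.cong (λ i → coeff h (2 ℕ.* i)) (≡.sym (toℕ-fromℕ r)))) top≈0))

-- Irreducibility and strict inclusion of coordinate subspaces.

module CoordinateSubspaces {c ℓ : Level} (em : ExcludedMiddle (c ⊔ ℓ)) (k : CommutativeRing c ℓ)
  (isField : Polynomials.IsField k) (char0 : Polynomials.CharacteristicZero k) (n : ℕ) where

  open CommutativeRing k hiding (zero)
  open Polynomials k
  open RingPolynomials k
  open FieldPolynomials em k isField char0
  open ZariskiTopology em k isField char0
  open EvenPolynomials em k isField char0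
  open Coordinates n
  open import Algebra.Properties.Group +-group using (x∙y⁻¹≈ε⇒x≈y; x≈y⇒x∙y⁻¹≈ε; identityʳ-unique)

  segment : Carrier → Carrier → Carrier → Carrier
  segment x y t = x + t * (y + - x)

  segment-polynomial : ∀ x y → PolynomialFunction (segment x y)
  segment-polynomial x y = (x ∷ y + - x ∷ []) , λ t → sym (evalₚ-linear x (y + - x) t)

  segment-0 : ∀ x y → segment x y 0# ≈ x
  segment-0 x y = trans (+-congˡ (zeroˡ _)) (+-identityʳ x)

  segment-1 : ∀ x y → segment x y 1# ≈ y
  segment-1 x y = trans (+-congˡ (*-identityˡ _)) (trans (+-comm x _) (x-s+s≈x y x))

  segment-const : ∀ {x y a} t → x ≈ a → y ≈ a → segment x y t ≈ a
  segment-const {x} {y} {a} t x≈a y≈a = trans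
    (+-cong x≈a (trans (*-congˡ (x≈y⇒x∙y⁻¹≈ε (trans y≈a (sym x≈a)))) (zeroʳ t))) (+-identityʳ a)

  -- Two points of 𝒫 (suc n) are joined by a segment in the coordinates ξ, of which only finitely
  -- many points lie outside the two open sets or fail to be of degree suc n.
  join : ∀ {f f′ : MvPoly (suc (suc n))} {g h} → g ∈D f → h ∈D f′ →
         Σ[ z ∈ 𝒫 (suc n) ] z ∈D f × z ∈D f′ ×
         (Σ[ t ∈ Carrier ] ∀ i → i ℕ.≤ suc n → ξ z i ≈ segment (ξ g i) (ξ h i) t)
  join {f} {f′} {g} {h} fg≉0 f′h≉0 =
    let t , F≉0 , F′≉0 = common-nonzero (weighted f) (weighted f′)
          (weighted≉0 f {0#} {g} (λ i → segment-0 (ξ g i) (ξ h i)) fg≉0)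
          (weighted≉0 f′ {1#} {h} (λ i → segment-1 (ξ g i) (ξ h i)) f′h≉0)
        top≉0 = λ top≈0 → F≉0 (trans (*-congʳ top≈0) (zeroˡ _))
    in point (x t) top≉0
     , (λ f≈0 → F≉0 (trans (*-congˡ f≈0) (zeroʳ _)))
     , (λ f′≈0 → F′≉0 (trans (*-congˡ f′≈0) (zeroʳ _)))
     , t , ξ-point (x t) top≉0
    where
    open IsSubalgebra polynomialFunctions

    x : Carrier → ℕ → Carrier
    x t i = segment (ξ g i) (ξ h i) t

    x-polynomial : ∀ i → PolynomialFunction (λ t → x t i)
    x-polynomial i = segment-polynomial (ξ g i) (ξ h i)

    -- The factor `x t (suc n)` is the leading coefficient, so a nonzero weight ensures both degree
    -- exactly `suc n` and a nonzero value of `f`.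
    weight : MvPoly (suc (suc n)) → Carrier → Carrier
    weight f t = x t (suc n) * eval f (φ (x t))

    weighted : ∀ f → PolynomialFunction (weight f)
    weighted f = times (x-polynomial (suc n)) (eval-closed {a = λ t → φ (x t)} (φ-polynomial x-polynomial) f)

    weighted≉0 : ∀ f {t z} → (∀ i → x t i ≈ ξ z i) → z ∈D f → ¬ (weight f t ≈ 0#)
    weighted≉0 f {t} {z} x≈ξz fz≉0 = *-≉0
      (λ top≈0 → proj₂ z (trans (sym (trans (x≈ξz (suc n)) (ξ-top z))) top≈0))
      (λ f≈0 → fz≉0 (trans (eval-cong f (λ i → sym (trans (φ-cong x≈ξz i) (φ-ξ z i)))) f≈0))

  δ : ℕ → ℕ → Carrier
  δ j i with i ℕₚ.≟ j
  ... | yes _ = 1#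
  ... | no  _ = 0#

  δ-≡ : ∀ j → δ j j ≡ 1#
  δ-≡ j with j ℕₚ.≟ j
  ... | yes _  = ≡.refl
  ... | no j≢j = ⊥-elim (j≢j ≡.refl)

  δ-≢ : ∀ {i j} → i ≢ j → δ j i ≡ 0#
  δ-≢ {i} {j} i≢j with i ℕₚ.≟ j
  ... | yes i≡j = ⊥-elim (i≢j i≡j)
  ... | no  _   = ≡.refl

  -- The coordinates of the monomial of degree suc n.
  e : ℕ → Carrier
  e = δ (suc n)

  -- The fixed coordinates agree with those of the monomial of degree `suc n` instead of all being
  -- zero: a zero leading coordinate would leave `𝒫 (suc n)`.
  Subspace : Pred ℕ 0ℓ → Pred (𝒫 (suc n)) (c ⊔ ℓ)
  Subspace Q = zeroSet {I = Σ ℕ Q} λ (i , _) g → ξ g i + - e i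

  ∈-Subspace : ∀ {Q g} → (∀ i → Q i → ξ g i ≈ e i) → g ∈ Subspace Q
  ∈-Subspace ξ≈e = lift λ (i , Qi) → x≈y⇒x∙y⁻¹≈ε (ξ≈e i Qi)

  Subspace-ξ : ∀ {Q g} → g ∈ Subspace Q → ∀ i → Q i → ξ g i ≈ e i
  Subspace-ξ (lift z) i Qi = x∙y⁻¹≈ε⇒x≈y _ _ (z (i , Qi))

  Subspace-closed : ∀ Q → IsClosed (Subspace Q)
  Subspace-closed Q = zeroSet-closed λ (i , _) → plus (ξ-regular i) (const (- e i))
    where open IsSubalgebra regularFunctions

  module _ {Q : Pred ℕ 0ℓ} (bounded : ∀ i → Q i → i ℕ.≤ suc n) where

    Subspace-satisfiable : Satisfiable (Subspace Q)
    Subspace-satisfiable = point e top≉0 , ∈-Subspace {Q} {point e top≉0} λ i Qi → ξ-point e top≉0 i (bounded i Qi)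
      where
      top≉0 : ¬ (e (suc n) ≈ 0#)
      top≉0 top≈0 = 1≉0 (trans (sym (reflexive (δ-≡ (suc n)))) top≈0)

    -- Were there one point outside `A` and one outside `B`, the segment joining them would stay in
    -- the subspace and contain a point outside both.
    Subspace-irreducible : IsIrreducible (Subspace Q)
    Subspace-irreducible = Subspace-satisfiable , split
      where
      split : ∀ (A B : Pred (𝒫 (suc n)) (c ⊔ ℓ)) → IsClosed A → IsClosed B →
              Subspace Q ⊆ A ∪ B → (Subspace Q ⊆ A) ⊎ (Subspace Q ⊆ B)
      split A B A-closed@(_ , A⊆ , _) B-closed@(_ , B⊆ , _) cover
        with em {Subspace Q ⊆ A} | em {Subspace Q ⊆ B}
      ... | yes ⊆A | _      = inj₁ ⊆A
      ... | no  _  | yes ⊆B = inj₂ ⊆B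
      ... | no  ⊈A | no ⊈B  =
        let g , g∈Q , g∉A = outside ⊈A
            h , h∈Q , h∉B = outside ⊈B
            f , f∈S , fg≉0 = separate A-closed g∉A
            f′ , f′∈S , f′h≉0 = separate B-closed h∉B
            z , fz≉0 , f′z≉0 , t , ξz = join {f} {f′} {g} {h} fg≉0 f′h≉0
            z∈Q = ∈-Subspace {Q} {z} λ i Qi → trans (ξz i (bounded i Qi))
                    (segment-const t (Subspace-ξ {Q} {g} g∈Q i Qi) (Subspace-ξ {Q} {h} h∈Q i Qi))
        in ⊥-elim (absurd f∈S f′∈S fz≉0 f′z≉0 (cover z∈Q))
        where
        absurd : ∀ {z f f′} → f ∈ proj₁ A-closed → f′ ∈ proj₁ B-closed → z ∈D f → z ∈D f′ → ¬ (z ∈ A ∪ B)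
        absurd f∈S f′∈S fz≉0 f′z≉0 (inj₁ z∈A) = fz≉0 (A⊆ z∈A f∈S)
        absurd f∈S f′∈S fz≉0 f′z≉0 (inj₂ z∈B) = f′z≉0 (B⊆ z∈B f′∈S)

    Subspace-⊂ : ∀ {Q′ : Pred ℕ 0ℓ} j → Q′ ⊆ Q → Q j → ¬ Q′ j → Subspace Q ⊂ Subspace Q′
    Subspace-⊂ {Q′} j Q′⊆Q Qj ¬Q′j = (λ {g} g∈Q → ∈-Subspace {Q′} {g} λ i Q′i → Subspace-ξ {Q} {g} g∈Q i (Q′⊆Q Q′i)) ,
      λ Q′⊆ → 1≉0 (trans (reflexive (≡.sym (δ-≡ j))) (identityʳ-unique (e j) (δ j j)
        (trans (sym (ξ-point x top≉0 j (bounded j Qj))) (Subspace-ξ {Q} {point x top≉0} (Q′⊆ {point x top≉0} x∈Q′) j Qj))))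
      where
      -- The base point with coordinate `j` raised by one satisfies the conditions `Q′` and violates
      -- the one at `j`. If `j` is the leading index, its coordinate is 2, nonzero in characteristic
      -- zero.
      x : ℕ → Carrier
      x i = e i + δ j i

      top≉0 : ¬ (x (suc n) ≈ 0#)
      top≉0 with suc n ℕₚ.≟ j
      ... | yes _ = λ 1+1≈0 → char0 1 (trans (+-cong refl (+-identityʳ 1#))
                                (trans (+-congʳ (reflexive (≡.sym (δ-≡ (suc n))))) 1+1≈0))
      ... | no  _ = λ 1+0≈0 → 1≉0 (trans (reflexive (≡.sym (δ-≡ (suc n)))) (trans (sym (+-identityʳ _)) 1+0≈0))

      x∈Q′ : point x top≉0 ∈ Subspace Q′
      x∈Q′ = ∈-Subspace {Q′} {point x top≉0} λ i Q′i → trans (ξ-point x top≉0 i (bounded i (Q′⊆Q Q′i)))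
        (trans (+-congˡ (reflexive (δ-≢ {i} {j} λ { ≡.refl → ¬Q′j Q′i }))) (+-identityʳ (e i)))

-- The even locus as a member of a coordinate flag: dimension and codimension.

module EvenLocus {c ℓ : Level} (em : ExcludedMiddle (c ⊔ ℓ)) (k : CommutativeRing c ℓ)
  (isField : Polynomials.IsField k) (char0 : Polynomials.CharacteristicZero k) (q : ℕ) where

  -- Here r = q + 1, so that 2 r = n + 1 holds by computation.
  n : ℕ
  n = q ℕ.+ suc (q ℕ.+ 0)

  n≡1+2q : n ≡ suc (2 ℕ.* q)
  n≡1+2q = ℕₚ.+-suc q (q ℕ.+ 0)

  open CommutativeRing k hiding (zero)
  open Polynomials k
  open RingPolynomials k
  open FieldPolynomials em k isField char0
  open ZariskiTopology em k isField char0
  open EvenPolynomials em k isField char0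
  open Coordinates n
  open CoordinateSubspaces em k isField char0 n
  open import Relation.Binary.Reasoning.Setoid setoid

  -- The degree `n` is odd, so translation by `b` kills that coefficient, which only the center
  -- does.
  even-center : ∀ (g : 𝒫 (suc n)) b G → toPoly g ≈ₚ compose G [Y- b ]² → b ≈ center g
  even-center g b G g≈ = centered-unique g b (trans (even⇒τ b (toPoly g) G g≈ n)
    (reflexive (≡.trans (≡.cong (coeff (dilate G)) n≡1+2q) (coeff-dilate-odd G q))))

  -- The image determines `b` as its center, and then `G` through the even coefficients of the
  -- translate by `b`.
  incidence-injective : IsInjectiveMap (incidence (suc q))
  incidence-injective = (λ {x} {y} → congruent {x} {y}) , λ {x} {y} → injective {x} {y}
    where
    congruent : ∀ {x y : Carrier × 𝒫 (suc q)} → x ≈𝔸×𝒫 y → incidence (suc q) x ≈𝒫 incidence (suc q) y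
    congruent {b , G} {b′ , G′} (b≈b′ , G≈G′) i =
      evalₚ-injective (compose (toPoly G) [Y- b ]²) (compose (toPoly G′) [Y- b′ ]²)
        (λ x → begin
          evalₚ (compose (toPoly G) [Y- b ]²) x         ≈⟨ evalₚ-compose (toPoly G) [Y- b ]² x ⟩
          evalₚ (toPoly G) (evalₚ [Y- b ]² x)           ≈⟨ evalₚ-cong (toPoly G) (toPoly G′)
                                                             (toList-cong (proj₁ G) (proj₁ G′) G≈G′) (square x) ⟩
          evalₚ (toPoly G′) (evalₚ [Y- b′ ]² x)         ≈⟨ evalₚ-compose (toPoly G′) [Y- b′ ]² x ⟨
          evalₚ (compose (toPoly G′) [Y- b′ ]²) x       ∎) (toℕ i)
      where
      square : ∀ x → evalₚ [Y- b ]² x ≈ evalₚ [Y- b′ ]² x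
      square x = trans (evalₚ-[Y-]² b x) (trans (*-cong x-b x-b) (sym (evalₚ-[Y-]² b′ x)))
        where
        x-b : x + - b ≈ x + - b′
        x-b = +-congˡ (-‿cong b≈b′)

    injective : ∀ {x y : Carrier × 𝒫 (suc q)} → incidence (suc q) x ≈𝒫 incidence (suc q) y → x ≈𝔸×𝒫 y
    injective {b , G} {b′ , G′} g≈g′ = b≈b′ , λ i → begin
        proj₁ G i                                   ≡⟨ coeff-toPoly G i ⟨
        coeff (toPoly G) (toℕ i)                    ≡⟨ coeff-dilate-even (toPoly G) (toℕ i) ⟨
        coeff (dilate (toPoly G)) (2 ℕ.* toℕ i)     ≈⟨ dilates (2 ℕ.* toℕ i) ⟩
        coeff (dilate (toPoly G′)) (2 ℕ.* toℕ i)    ≡⟨ coeff-dilate-even (toPoly G′) (toℕ i) ⟩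
        coeff (toPoly G′) (toℕ i)                   ≡⟨ coeff-toPoly G′ i ⟩
        proj₁ G′ i                                  ∎
      where
      g g′ : 𝒫 (suc n)
      g  = incidence (suc q) (b , G)
      g′ = incidence (suc q) (b′ , G′)

      g≈ : toPoly g ≈ₚ compose (toPoly G) [Y- b ]²
      g≈ = incidence-correct (suc q) b G

      g≈′ : toPoly g ≈ₚ compose (toPoly G′) [Y- b′ ]²
      g≈′ i = trans (toList-cong (proj₁ g) (proj₁ g′) g≈g′ i) (incidence-correct (suc q) b′ G′ i)

      b≈b′ : b ≈ b′
      b≈b′ = trans (even-center g b (toPoly G) g≈) (sym (even-center g b′ (toPoly G′) g≈′))

      dilates : dilate (toPoly G) ≈ₚ dilate (toPoly G′)
      dilates i = trans (sym (even⇒τ b (toPoly g) (toPoly G) g≈ i))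
        (trans (τ-cong (toPoly g) (toPoly g) b≈b′ (λ _ → refl) i) (even⇒τ b′ (toPoly g) (toPoly G′) g≈′ i))

  -- A coordinate of rank w is free exactly on the members of the flag of index > w. Along the
  -- flag one frees first the even coefficients, then the center, and then the odd coefficients.
  data Rank (i : ℕ) : ℕ → Set where
    even   : ∀ t → i ≡ 2 ℕ.* t → t ℕ.≤ suc q → Rank i t
    middle : i ≡ n → Rank i (2 ℕ.+ q)
    odd    : ∀ t → i ≡ suc (2 ℕ.* t) → t ℕ.< q → Rank i (3 ℕ.+ q ℕ.+ t)

  rank-unique : ∀ {i v w} → Rank i v → Rank i w → v ≡ w
  rank-unique (even s i≡ _) (even t i≡′ _) = ℕₚ.*-cancelˡ-≡ s t 2 (≡.trans (≡.sym i≡) i≡′)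
  rank-unique (even s i≡ _) (middle i≡′)   = ⊥-elim (ℕₚ.even≢odd s q (≡.trans (≡.sym i≡) (≡.trans i≡′ n≡1+2q)))
  rank-unique (even s i≡ _) (odd t i≡′ _)  = ⊥-elim (ℕₚ.even≢odd s t (≡.trans (≡.sym i≡) i≡′))
  rank-unique (middle i≡)   (middle i≡′)   = ≡.refl
  rank-unique (middle i≡)   (odd t i≡′ t<q) = ⊥-elim (ℕₚ.<⇒≢ t<q (ℕₚ.*-cancelˡ-≡ t q 2
    (ℕₚ.suc-injective (≡.trans (≡.sym i≡′) (≡.trans i≡ n≡1+2q)))))
  rank-unique (odd s i≡ _)  (odd t i≡′ _)  = ≡.cong (3 ℕ.+ q ℕ.+_) (ℕₚ.*-cancelˡ-≡ s t 2
    (ℕₚ.suc-injective (≡.trans (≡.sym i≡) i≡′)))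
  rank-unique v@(middle _)  w@(even _ _ _) = ≡.sym (rank-unique w v)
  rank-unique v@(odd _ _ _) w@(even _ _ _) = ≡.sym (rank-unique w v)
  rank-unique v@(odd _ _ _) w@(middle _)   = ≡.sym (rank-unique w v)

  rank-bounded : ∀ {i w} → Rank i w → i ℕ.≤ suc n
  rank-bounded (even t ≡.refl t≤1+q) = ℕₚ.*-monoʳ-≤ 2 t≤1+q
  rank-bounded (middle ≡.refl)       = ℕₚ.n≤1+n n
  rank-bounded (odd t ≡.refl t<q)    = ℕₚ.<⇒≤ (ℕₚ.≤-trans
    (ℕₚ.≤-reflexive (≡.sym (ℕₚ.*-suc 2 t))) (ℕₚ.*-monoʳ-≤ 2 (ℕₚ.m≤n⇒m≤1+n t<q)))

  1+n≡2+2q : suc n ≡ 2 ℕ.+ q ℕ.+ q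
  1+n≡2+2q = ≡.cong suc (≡.trans n≡1+2q (≡.cong (λ x → suc (q ℕ.+ x)) (ℕₚ.+-identityʳ q)))

  -- Ranks have no gaps: 0 to q + 1 belong to the even coefficients, q + 2 to the center, and the
  -- next `q` to the odd coefficients. This provides a coordinate to free at every step of the flag.
  rank-exists : ∀ w → w ℕ.≤ suc n → Σ[ i ∈ ℕ ] Rank i w
  rank-exists w w≤ with w ℕₚ.≤? suc q
  ... | yes w≤1+q = 2 ℕ.* w , even w ≡.refl w≤1+q
  ... | no  w≰1+q with ℕₚ.m≤n⇒∃[o]m+o≡n (ℕₚ.≰⇒> w≰1+q)
  ...   | zero  , ≡.refl = n , ≡.subst (Rank n) (≡.sym (ℕₚ.+-identityʳ (2 ℕ.+ q))) (middle ≡.refl)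
  ...   | suc t , ≡.refl = suc (2 ℕ.* t) , ≡.subst (Rank _) (≡.sym (ℕₚ.+-suc (2 ℕ.+ q) t))
            (odd t ≡.refl (ℕₚ.+-cancelˡ-≤ (2 ℕ.+ q) (suc t) q (ℕₚ.≤-trans w≤ (ℕₚ.≤-reflexive 1+n≡2+2q))))

  Fixed : ℕ → Pred ℕ 0ℓ
  Fixed j i = Σ[ w ∈ ℕ ] Rank i w × j ℕ.≤ w

  fixed-bounded : ∀ j i → Fixed j i → i ℕ.≤ suc n
  fixed-bounded j i (_ , rank , _) = rank-bounded rank

  -- `Flag j` has `j` free coordinates. `Flag 0` is the monomial alone, `Flag (3 ℕ.+ q)` will be the
  -- even locus, and `Flag (2 ℕ.+ n)` is the whole space.
  Flag : ℕ → Pred (𝒫 (suc n)) (c ⊔ ℓ)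
  Flag j = Subspace (Fixed j)

  flag-closed : ∀ j → IsClosed (Flag j)
  flag-closed j = Subspace-closed (Fixed j)

  flag-irreducible : ∀ j → IsIrreducible (Flag j)
  flag-irreducible j = Subspace-irreducible (fixed-bounded j)

  -- The coordinate of rank `j` is fixed in `Flag j` and, by uniqueness of ranks, free in the next
  -- member.
  flag-strict : ∀ j → j ℕ.≤ suc n → Flag j ⊂ Flag (suc j)
  flag-strict j j≤ with rank-exists j j≤
  ... | i , rank = Subspace-⊂ (fixed-bounded j) i
    (λ (w , rank′ , j<w) → w , rank′ , ℕₚ.<⇒≤ j<w)
    (j , rank , ℕₚ.≤-refl)
    (λ (w , rank′ , j<w) → ℕₚ.<⇒≢ j<w (rank-unique rank rank′))

  flag-mono : ∀ {i j} → i ℕ.≤ j → Flag i ⊆ Flag j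
  flag-mono {i} {j} i≤j {g} g∈ = ∈-Subspace {Fixed j} {g} λ h (w , rank , j≤w) →
    Subspace-ξ {Fixed i} {g} g∈ h (w , rank , ℕₚ.≤-trans i≤j j≤w)

  even⊆flag : ℰ (suc n) ⊆ Flag (3 ℕ.+ q)
  even⊆flag {g} (b , G , g≈) = ∈-Subspace {Fixed (3 ℕ.+ q)} {g} λ
    -- Even coefficients and the center have rank below 3 + q and are free, so only the odd
    -- coefficients impose conditions.
    { i (w , even t i≡ t≤ , q<w) → ⊥-elim (ℕₚ.<⇒≱ (ℕₚ.m≤n⇒m≤1+n q<w) (s≤s t≤))
    ; i (w , middle i≡ , q<w)    → ⊥-elim (ℕₚ.<⇒≱ q<w ℕₚ.≤-refl)
    ; i (w , odd t ≡.refl t<q , q<w) → odd-zero t t<q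
    }
    where
    odd-zero : ∀ t → t ℕ.< q → ξ g (suc (2 ℕ.* t)) ≈ e (suc (2 ℕ.* t))
    odd-zero t t<q = begin
      ξ g (suc (2 ℕ.* t))
        ≡⟨ ξ-coeff g (λ i≡n → ℕₚ.<⇒≢ t<q (ℕₚ.*-cancelˡ-≡ t q 2 (ℕₚ.suc-injective (≡.trans i≡n n≡1+2q)))) ⟩
      coeff (centered g) (suc (2 ℕ.* t))
        ≈⟨ τ-cong (toPoly g) (toPoly g) (even-center g b G g≈) (λ _ → refl) (suc (2 ℕ.* t)) ⟨
      coeff (τ b (toPoly g)) (suc (2 ℕ.* t))
        ≈⟨ even⇒τ b (toPoly g) G g≈ (suc (2 ℕ.* t)) ⟩
      coeff (dilate G) (suc (2 ℕ.* t))
        ≡⟨ coeff-dilate-odd G t ⟩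
      0#
        ≡⟨ δ-≢ (λ i≡m → ℕₚ.even≢odd (suc q) t (≡.sym i≡m)) ⟨
      e (suc (2 ℕ.* t)) ∎

  -- The odd coefficients of the centered polynomial vanish for three reasons: below degree `n` by
  -- membership in the flag, in degree `n` by centering, above it because the degree is `suc n`.
  flag⇒even : ∀ g → g ∈ Flag (3 ℕ.+ q) → Σ[ G ∈ 𝒫 (suc q) ] toPoly g ≈ₚ compose (toPoly G) [Y- center g ]²
  flag⇒even g g∈ = odd-free⇒even (suc q) g (center g) odd-zero
    where
    odd-zero : ∀ t → coeff (centered g) (suc (2 ℕ.* t)) ≈ 0#
    odd-zero t with ℕₚ.<-cmp t q
    ... | tri< t<q t≢q _ = begin
      coeff (centered g) (suc (2 ℕ.* t))
        ≡⟨ ξ-coeff g (λ i≡n → t≢q (ℕₚ.*-cancelˡ-≡ t q 2 (ℕₚ.suc-injective (≡.trans i≡n n≡1+2q)))) ⟨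
      ξ g (suc (2 ℕ.* t))
        ≈⟨ Subspace-ξ {Fixed (3 ℕ.+ q)} {g} g∈ (suc (2 ℕ.* t)) (_ , odd t ≡.refl t<q , ℕₚ.m≤m+n (3 ℕ.+ q) t) ⟩
      e (suc (2 ℕ.* t))
        ≡⟨ δ-≢ (λ i≡m → ℕₚ.even≢odd (suc q) t (≡.sym i≡m)) ⟩
      0# ∎
    ... | tri≈ _ ≡.refl _ = trans (reflexive (≡.cong (coeff (centered g)) (≡.sym n≡1+2q))) (centered-low g)
    ... | tri> _ _ q<t = coeff-τ-> (center g) (toPoly g) (suc (suc n)) (coeff-above g) (suc (2 ℕ.* t))
            (s≤s (ℕₚ.*-monoʳ-≤ 2 q<t))

  flag⊆even : Flag (3 ℕ.+ q) ⊆ ℰ (suc n)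
  flag⊆even {g} g∈ = let G , g≈ = flag⇒even g g∈ in center g , toPoly G , g≈

  flag≐even : Flag (3 ℕ.+ q) ≐ ℰ (suc n)
  flag≐even = (λ {g} → flag⊆even {g}) , (λ {g} → even⊆flag {g})

  even-closed : IsClosed (ℰ (suc n))
  even-closed = IsClosed-resp flag≐even (flag-closed (3 ℕ.+ q))

  flag≐closure : Flag (3 ℕ.+ q) ≐ closure (ℰ (suc n))
  flag≐closure = (λ {g} g∈ {f} → ⊆-closure (ℰ (suc n)) {g} (flag⊆even {g} g∈) {f})
               , closure-least (ℰ (suc n)) (Flag (3 ℕ.+ q)) (flag-closed (3 ℕ.+ q)) (λ {g} → even⊆flag {g})

  even≐image : ℰ (suc n) ≐ Image (incidence (suc q))
  even≐image = (λ {g} → to {g}) , (λ {g} → from {g})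
    where
    to : ℰ (suc n) ⊆ Image (incidence (suc q))
    to {g} g∈ = let G , g≈ = flag⇒even g (even⊆flag {g} g∈) in (center g , G) ,
      coeffs-injective (incidence (suc q) (center g , G)) g
        (λ i → trans (incidence-correct (suc q) (center g) G i) (sym (g≈ i)))

    from : Image (incidence (suc q)) ⊆ ℰ (suc n)
    from {g} ((b , G) , φ≈g) = b , toPoly G , λ i →
      trans (sym (toList-cong (proj₁ (incidence (suc q) (b , G))) (proj₁ g) φ≈g i)) (incidence-correct (suc q) b G i)

  even-constructible : IsConstructible (ℰ (suc n))
  even-constructible = 1 , (λ _ _ → Lift _ ⊤) , (λ _ → ℰ (suc n))
    -- One piece suffices, the locus being closed. The whole space is open because its complement is
    -- cut out by all polynomials, including the constant `1#`.
    , (λ _ → (λ _ → Lift _ ⊤) , (λ g∉ → ⊥-elim (g∉ (lift tt))) , λ z _ → 1≉0 (z {con 1#} (lift tt)))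
    , (λ _ → even-closed)
    , (λ g∈ → zero , lift tt , g∈) , λ (_ , _ , g∈) → g∈

  even-irreducible : IsIrreducible (ℰ (suc n))
  even-irreducible = IsIrreducible-resp flag≐even (flag-irreducible (3 ℕ.+ q))

  -- Segments of the flag: below the even locus, above it, or through the whole space.
  module _ (j l : ℕ) (j+l≤ : j ℕ.+ l ℕ.≤ 2 ℕ.+ n) where

    segment-strict : ∀ (i : Fin l) → Flag (j ℕ.+ toℕ (inject₁ i)) ⊂ Flag (j ℕ.+ suc (toℕ i))
    segment-strict i = ≡.subst₂ (λ a b → Flag a ⊂ Flag b)
      (≡.cong (j ℕ.+_) (≡.sym (toℕ-inject₁ i))) (≡.sym (ℕₚ.+-suc j (toℕ i)))
      (flag-strict (j ℕ.+ toℕ i) (ℕₚ.≤-pred (ℕₚ.≤-trans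
        (ℕₚ.≤-reflexive (≡.sym (ℕₚ.+-suc j (toℕ i)))) (ℕₚ.≤-trans (ℕₚ.+-monoʳ-≤ j (toℕ<n i)) j+l≤))))

    flagChain : ∀ {a} {X : Pred (𝒫 (suc n)) a} → Flag (j ℕ.+ l) ⊆ X → Chain X l
    flagChain ⊆X = record
      { Z           = λ i → Flag (j ℕ.+ toℕ i)
      ; closed      = λ i → flag-closed (j ℕ.+ toℕ i)
      ; irreducible = λ i → flag-irreducible (j ℕ.+ toℕ i)
      ; strict      = segment-strict
      ; inside      = λ i {g} g∈ → ⊆X (flag-mono (ℕₚ.+-monoʳ-≤ j (toℕ≤pred[n] i)) {g} g∈)
      }

    flag-independent : ∀ {d} → Independent (Flag j) d → Independent (Flag (j ℕ.+ l)) (l ℕ.+ d)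
    flag-independent {d} ind = ≡.subst (λ i → Independent (Flag (j ℕ.+ i)) (l ℕ.+ d)) (toℕ-fromℕ l)
      (independent-chain l (λ i → Flag (j ℕ.+ toℕ i)) (λ i → flag-closed (j ℕ.+ toℕ i))
        (λ i → flag-irreducible (j ℕ.+ toℕ i)) segment-strict
        (≡.subst (λ i → Independent (Flag i) d) (≡.sym (ℕₚ.+-identityʳ j)) ind))

  chain-independent : ∀ {a d l} {X : Pred (𝒫 (suc n)) a} (C : Chain X l) →
                      Independent (Chain.Z C zero) d → Independent (Chain.Z C (fromℕ l)) (l ℕ.+ d)
  chain-independent {l = l} C = independent-chain l Z closed irreducible strict
    where open Chain C

  chain-independent₀ : ∀ {a l} {X : Pred (𝒫 (suc n)) a} (C : Chain X l) → Independent (Chain.Z C (fromℕ l)) l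
  chain-independent₀ {l = l} C = ≡.subst (Independent (Chain.Z C (fromℕ l))) (ℕₚ.+-identityʳ l)
    (chain-independent C (independent-zero (proj₁ (Chain.irreducible C zero))))

  2+n≡3+q+q : 2 ℕ.+ n ≡ 3 ℕ.+ q ℕ.+ q
  2+n≡3+q+q = ≡.cong suc 1+n≡2+2q

  r+2≡3+q : suc q ℕ.+ 2 ≡ 3 ℕ.+ q
  r+2≡3+q = ℕₚ.+-comm (suc q) 2

  2r+1≡2+n : suc n ℕ.+ 1 ≡ 2 ℕ.+ n
  2r+1≡2+n = ℕₚ.+-comm (suc n) 1

  2r+1∸[r+2]≡q : (suc n ℕ.+ 1) ℕ.∸ (suc q ℕ.+ 2) ≡ q
  2r+1∸[r+2]≡q = ≡.trans (≡.cong₂ ℕ._∸_ (≡.trans 2r+1≡2+n 2+n≡3+q+q) r+2≡3+q) (ℕₚ.m+n∸m≡n (3 ℕ.+ q) q)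

  -- The flag up to 3 + q attains the value. A chain of length `l` yields `l` independent functions
  -- on the even locus, and the `q` further steps of the flag raise this to q + l, which is at most
  -- 2 + n = q + (3 + q).
  even-dimension : HasDimension (closure (ℰ (suc n))) (suc q ℕ.+ 2)
  even-dimension = ≡.subst (HasDimension (closure (ℰ (suc n)))) (≡.sym r+2≡3+q)
    ( flagChain 0 (3 ℕ.+ q) (ℕₚ.≤-trans (ℕₚ.m≤m+n (3 ℕ.+ q) q) (ℕₚ.≤-reflexive (≡.sym 2+n≡3+q+q))) (proj₁ flag≐closure)
    , λ l C → ℕₚ.+-cancelˡ-≤ q l (3 ℕ.+ q) (ℕₚ.≤-trans
        (independent-bound (flag-independent (3 ℕ.+ q) q (ℕₚ.≤-reflexive (≡.sym 2+n≡3+q+q))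
          (independent-⊆ (λ {g} g∈ → proj₂ flag≐closure {g} (λ {f} → Chain.inside C (fromℕ l) g∈ {f})) (chain-independent₀ C))))
        (ℕₚ.≤-reflexive (≡.trans 2+n≡3+q+q (ℕₚ.+-comm (3 ℕ.+ q) q)))))

  whole-dimension : HasDimension (U {A = 𝒫 (suc n)}) (suc n ℕ.+ 1)
  whole-dimension = ≡.subst (HasDimension (U {A = 𝒫 (suc n)})) (≡.sym 2r+1≡2+n)
    (flagChain 0 (2 ℕ.+ n) ℕₚ.≤-refl _ , λ l C → independent-bound (chain-independent₀ C))

  -- The `q` steps of the flag above the even locus attain the value. The 3 + q steps below it yield
  -- as many independent functions there, and a chain of length `l` starting at the locus raises
  -- this to l + (3 + q), at most 2 + n.
  even-codimension : HasCodimension (closure (ℰ (suc n))) ((suc n ℕ.+ 1) ℕ.∸ (suc q ℕ.+ 2))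
  even-codimension = ≡.subst (HasCodimension (closure (ℰ (suc n)))) (≡.sym 2r+1∸[r+2]≡q)
    ( ( flagChain (3 ℕ.+ q) q 3+q+q≤ _
      , ≡.subst (λ j → Flag j ≐ closure (ℰ (suc n))) (≡.sym (ℕₚ.+-identityʳ (3 ℕ.+ q))) flag≐closure)
    , λ l (C , bottom≐) → ℕₚ.+-cancelʳ-≤ (3 ℕ.+ q) l q (ℕₚ.≤-trans
        (independent-bound (chain-independent C
          (independent-⊆ (λ {g} g∈ → proj₂ bottom≐ (λ {f} → proj₁ flag≐closure {g} g∈ {f})) flag-3+q-independent)))
        (ℕₚ.≤-reflexive (≡.trans 2+n≡3+q+q (ℕₚ.+-comm (3 ℕ.+ q) q)))))
    where
    3+q+q≤ : 3 ℕ.+ q ℕ.+ q ℕ.≤ 2 ℕ.+ n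
    3+q+q≤ = ℕₚ.≤-reflexive (≡.sym 2+n≡3+q+q)

    flag-3+q-independent : Independent (Flag (3 ℕ.+ q)) (3 ℕ.+ q)
    flag-3+q-independent = ≡.subst (Independent (Flag (3 ℕ.+ q))) (ℕₚ.+-identityʳ (3 ℕ.+ q))
      (flag-independent 0 (3 ℕ.+ q) (ℕₚ.≤-trans (ℕₚ.m≤m+n (3 ℕ.+ q) q) 3+q+q≤)
        (independent-zero (proj₁ (flag-irreducible 0))))

  -- For q ≥ 1 the flag has a further step above 3 + q, and its strictness gives a point off the
  -- locus.
  even-proper : 1 ℕ.≤ q → Satisfiable (∁ (ℰ (suc n)))
  even-proper 1≤q =
    let _ , ⊉ = flag-strict (3 ℕ.+ q) (ℕₚ.≤-trans (ℕₚ.≤-reflexive (ℕₚ.+-comm 1 (2 ℕ.+ q)))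
                  (ℕₚ.≤-trans (ℕₚ.+-monoʳ-≤ (2 ℕ.+ q) 1≤q) (ℕₚ.≤-reflexive (≡.sym 1+n≡2+2q))))
        g , _ , g∉ = outside ⊉
    in g , λ g∈ → g∉ (even⊆flag {g} g∈)

open import Data.Nat.Base using (ℕ; suc; _+_; _*_; _∸_; _≤_)

theorem8p13 : {c ℓ : Level} → ExcludedMiddle (c ⊔ ℓ) →
    (k : CommutativeRing c ℓ) → let open Polynomials k in
    IsField → AlgebraicallyClosed → CharacteristicZero →
    (m : ℕ) → 1 ≤ m →
    ((r : ℕ) → m ≡ suc (2 * r) → Empty (ℰ m))
    × ((r : ℕ) → m ≡ 2 * r →
    1 ≤ r
    × IsInjectiveMap (incidence r)
    × ℰ (2 * r) ≐ Image (incidence r)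
    × IsConstructible (ℰ (2 * r))
    × IsIrreducible (ℰ (2 * r))
    × HasDimension (closure (ℰ (2 * r))) (r + 2)
    × HasDimension (U {A = 𝒫 (2 * r)}) (2 * r + 1)
    × HasCodimension (closure (ℰ (2 * r))) ((2 * r + 1) ∸ (r + 2))
    × (2 * r + 1) ∸ (r + 2) ≡ r ∸ 1)
    × (3 ≤ m → Σ[ Z ∈ Pred (𝒫 m) (c ⊔ ℓ) ] (IsClosed Z × Satisfiable (∁ Z) × ℰ m ⊆ Z))
theorem8p13 {c} {ℓ} em k isField _ char0 m 1≤m = odd-case , even-case 1≤m , proper (parity m)
  where
  open CommutativeRing k using (1#; sym)
  open Polynomials k
  open EvenPolynomials em k isField char0 using (parity; odd⇒not-even)

  odd-case : (r : ℕ) → m ≡ suc (2 * r) → Empty (ℰ m)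
  odd-case r ≡.refl = odd⇒not-even r

  even-case : ∀ {m} → 1 ≤ m → (r : ℕ) → m ≡ 2 * r →
    1 ≤ r
    × IsInjectiveMap (incidence r)
    × ℰ (2 * r) ≐ Image (incidence r)
    × IsConstructible (ℰ (2 * r))
    × IsIrreducible (ℰ (2 * r))
    × HasDimension (closure (ℰ (2 * r))) (r + 2)
    × HasDimension (U {A = 𝒫 (2 * r)}) (2 * r + 1)
    × HasCodimension (closure (ℰ (2 * r))) ((2 * r + 1) ∸ (r + 2))
    × (2 * r + 1) ∸ (r + 2) ≡ r ∸ 1
  even-case ()  zero    ≡.refl
  even-case 1≤m (suc q) ≡.refl =
      s≤s z≤n , incidence-injective , even≐image , even-constructible , even-irreducible
    , even-dimension , whole-dimension , even-codimension , 2r+1∸[r+2]≡q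
    where open EvenLocus em k isField char0 q

  proper : (Σ[ r ∈ ℕ ] m ≡ 2 * r) ⊎ (Σ[ r ∈ ℕ ] m ≡ suc (2 * r)) →
           3 ≤ m → Σ[ Z ∈ Pred (𝒫 m) (c ⊔ ℓ) ] (IsClosed Z × Satisfiable (∁ Z) × ℰ m ⊆ Z)
  proper (inj₁ (suc zero    , ≡.refl)) (s≤s (s≤s ()))
  -- Here r - 1 = `suc q` is positive, so the locus, itself closed, serves as the proper closed set.
  proper (inj₁ (suc (suc q) , ≡.refl)) _ = ℰ m , even-closed , even-proper (s≤s z≤n) , λ g∈ → g∈
    where open EvenLocus em k isField char0 (suc q)
  -- In odd degree the empty set serves, cut out by all polynomials; the polynomial with every
  -- coefficient `1#` lies in its complement.
  proper (inj₂ (r , ≡.refl)) _ = (λ _ → Lift _ ⊥)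
    , ((λ _ → Lift _ ⊤) , (λ ()) , λ z → ⊥-elim (proj₁ isField (sym (z {con 1#} (lift tt)))))
    , (((λ _ → 1#) , λ 1≈0 → proj₁ isField (sym 1≈0)) , lower)
    , λ {g} g∈ → lift (odd⇒not-even r g g∈)
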